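{- Let $n$ and $m$ be positive integers, let $k$ be a positive divisor of $n$, and let $d=n/k$. Then the characteristic polynomial of the Laplacian matrix $L(\mathcal{C}(n,k,m))$ is $$x(x-1)^{m-1}(x-(n+1))^{m(n-1)-k+1}(x-(md+1))\bigl(x^2-(md+n+1)x+mdn\bigr)^{k-1}.$$
   Context: For positive integers $n,m$ and a positive divisor $k$ of $n$ with $d=n/k$, $\mathcal{C}(n,k,m)=\overline{K}_k\vee_k mK_n$ is the graph with vertex set $\{u_j: j\in\mathbb{Z}_k\}\cup\{v_{t,j,s}: 1\le t\le m,\ j\in\mathbb{Z}_k,\ 1\le s\le d\}$ whose edges are: all pairs of distinct vertices $v_{t,j,s},v_{t,j',s'}$ with the same $t$ (so for each $t$ the vertices $v_{t,\cdot,\cdot}$ induce a complete graph $K_n$), and $u_jv_{t,j,s}$ for all $t,j,s$; there are no other edges (the $u_j$ are pairwise nonadjacent). The Laplacian matrix is $L(G)=D(G)-A(G)$. -}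

module Defs where

open import Data.Nat as ℕ using (ℕ; zero; suc)
open import Data.Integer as ℤ using (ℤ; +_; 0ℤ; 1ℤ; -_)
open import Data.List using (List; []; _∷_; map; _++_; concatMap; allFin; length; lookup)
open import Data.Nat.ListAction using (sum)
open import Data.Fin using (Fin; zero; suc; punchIn)
open import Data.Fin.Properties as FinP using ()
open import Data.Bool using (Bool; true; false; if_then_else_; _∧_; not)
open import Relation.Nullary.Decidable using (⌊_⌋)
open import Relation.Binary.PropositionalEquality using (_≡_)

-- Polynomials in one variable x over ℤ, as little-endian coefficient lists.

Poly : Set
Poly = List ℤ

infixl 6 _+ₚ_
infixl 7 _*ₚ_

_+ₚ_ : Poly → Poly → Poly
[] +ₚ q = q
(a ∷ p) +ₚ [] = a ∷ p
(a ∷ p) +ₚ (b ∷ q) = (a ℤ.+ b) ∷ (p +ₚ q)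

scaleₚ : ℤ → Poly → Poly
scaleₚ a = map (a ℤ.*_)

_*ₚ_ : Poly → Poly → Poly
[] *ₚ q = []
(a ∷ p) *ₚ q = scaleₚ a q +ₚ (0ℤ ∷ (p *ₚ q))

negₚ : Poly → Poly
negₚ = scaleₚ (- 1ℤ)

constₚ : ℤ → Poly
constₚ a = a ∷ []

X : Poly
X = 0ℤ ∷ 1ℤ ∷ []

infixr 8 _^ₚ_
_^ₚ_ : Poly → ℕ → Poly
p ^ₚ zero = constₚ 1ℤ
p ^ₚ suc e = p *ₚ (p ^ₚ e)

coeff : Poly → ℕ → ℤ
coeff [] _ = 0ℤ
coeff (a ∷ p) zero = a
coeff (a ∷ p) (suc i) = coeff p i

-- equality of polynomials (coefficientwise; trailing zeros irrelevant)
infix 4 _≈ₚ_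
_≈ₚ_ : Poly → Poly → Set
p ≈ₚ q = ∀ i → coeff p i ≡ coeff q i

sumₚ : ∀ {n} → (Fin n → Poly) → Poly
sumₚ {zero} f = []
sumₚ {suc n} f = f zero +ₚ sumₚ (λ j → f (suc j))

signℤ : ℕ → ℤ
signℤ zero = 1ℤ
signℤ (suc i) = - signℤ i

det : ∀ {n} → (Fin n → Fin n → Poly) → Poly
det {zero} M = constₚ 1ℤ
det {suc n} M =
  sumₚ (λ j → constₚ (signℤ (Data.Fin.toℕ j)) *ₚ (M zero j *ₚ det (λ i j′ → M (suc i) (punchIn j j′))))

charPoly : ∀ {n} → (Fin n → Fin n → ℤ) → Poly
charPoly M = det (λ i j → (if ⌊ i FinP.≟ j ⌋ then X else []) +ₚ negₚ (constₚ (M i j)))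

-- Laplacian matrix L = D - A of a graph given by an enumeration of its
-- vertices and a 0/1 adjacency function.

adjMatrix : {V : Set} (vs : List V) (adj : V → V → ℕ) → Fin (length vs) → Fin (length vs) → ℕ
adjMatrix vs adj i j = adj (lookup vs i) (lookup vs j)

degree : {V : Set} (vs : List V) (adj : V → V → ℕ) → V → ℕ
degree vs adj x = sum (map (adj x) vs)

laplacian : {V : Set} (vs : List V) (adj : V → V → ℕ) → Fin (length vs) → Fin (length vs) → ℤ
laplacian vs adj i j =
  (if ⌊ i FinP.≟ j ⌋ then + degree vs adj (lookup vs i) else 0ℤ) ℤ.- + adjMatrix vs adj i j

-- The graph 𝒞(n,k,m) = K̄_k ∨_k mK_n, with n = k * d.
-- u j  (j ∈ ℤ_k);  v t j s  (t ∈ {1..m} as Fin m, j ∈ ℤ_k, s ∈ {1..d} as Fin d).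

data CVertex (k m d : ℕ) : Set where
  u : Fin k → CVertex k m d
  v : Fin m → Fin k → Fin d → CVertex k m d

eqF : ∀ {n} → Fin n → Fin n → Bool
eqF i j = ⌊ i FinP.≟ j ⌋

b2n : Bool → ℕ
b2n true = 1
b2n false = 0

cAdj : ∀ {k m d} → CVertex k m d → CVertex k m d → ℕ
cAdj (u j) (u j′) = 0
cAdj (u j) (v t j′ s) = b2n (eqF j j′)
cAdj (v t j s) (u j′) = b2n (eqF j j′)
cAdj (v t j s) (v t′ j′ s′) = b2n (eqF t t′ ∧ not (eqF j j′ ∧ eqF s s′))

cVertices : (k m d : ℕ) → List (CVertex k m d)
cVertices k m d =
  map u (allFin k) ++
  concatMap (λ t → concatMap (λ j → map (v t j) (allFin d)) (allFin k)) (allFin m)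

L𝒞 : (k m d : ℕ) → Fin (length (cVertices k m d)) → Fin (length (cVertices k m d)) → ℤ
L𝒞 k m d = laplacian (cVertices k m d) cAdj

X-_ : ℤ → Poly
X- c = X +ₚ constₚ (- c)

targetPoly : (n k m d : ℕ) → Poly
targetPoly n k m d =
  X *ₚ (X- (+ 1)) ^ₚ (m ℕ.∸ 1)
    *ₚ (X- (+ (n ℕ.+ 1))) ^ₚ (m ℕ.* (n ℕ.∸ 1) ℕ.+ 1 ℕ.∸ k)
    *ₚ (X- (+ (m ℕ.* d ℕ.+ 1)))
    *ₚ ((X *ₚ X) +ₚ negₚ (constₚ (+ (m ℕ.* d ℕ.+ n ℕ.+ 1)) *ₚ X) +ₚ constₚ (+ (m ℕ.* d ℕ.* n))) ^ₚ (k ℕ.∸ 1)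

{-# OPTIONS --safe #-}

-- Put y = x − (n+1) and z = x − 1.  In xI − L the cliques form diagonal blocks yI + J of size n,
-- whose determinant is y^(n-1) z and whose inverse is (1/y)(I − J/z).  Eliminating the cliques
-- leaves the Schur complement on the u_j, which after multiplication by yz becomes
-- (zQ)I + (md²)J with Q = x² − (md+n+1)x + mdn; its determinant is (zQ)^(k-1) · y x (x−(md+1)).
-- Hence (yz)^k · det(xI − L) is known, and (yz)^k is cancelled in ℤ[x].

module Submission where

open import Defs hiding (det)
import Defs
open import Algebra.Bundles using (CommutativeRing; Semiring)
open import Data.Bool using (true; false; Bool; if_then_else_; _∧_; not)
open import Data.Empty using (⊥-elim)
open import Data.Fin using (Fin; zero; suc; toℕ; punchIn; _↑ˡ_; _↑ʳ_; lift; cast; splitAt)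
open import Data.Fin.Properties using (_≟_; punchInᵢ≢i; suc-injective; cast-is-id; splitAt-↑ˡ; splitAt-↑ʳ)
open import Data.Integer as ℤ using (ℤ; +_; 0ℤ; 1ℤ)
import Data.Integer.Properties as ℤ
open import Data.Integer.Tactic.RingSolver using (solve-∀)
open import Data.List using (List; []; _∷_; map; _++_; concatMap; allFin; tabulate; length; lookup; foldr)
open import Data.List.Membership.Propositional using (_∈_)
open import Data.List.Membership.Propositional.Properties using (∈-lookup; ∈-map⁻; ∈-concatMap⁻)
open import Data.List.Properties using (length-++; length-map; length-tabulate)
open import Data.List.Relation.Binary.Disjoint.Propositional using (Disjoint)
open import Data.List.Relation.Unary.All as All using ([]; _∷_)
import Data.List.Relation.Unary.All.Properties as All
open import Data.List.Relation.Unary.AllPairs as AllPairs using (AllPairs; []; _∷_)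
import Data.List.Relation.Unary.AllPairs.Properties as AllPairs
open import Data.List.Relation.Unary.Any as Any using ()
open import Data.List.Relation.Unary.Unique.Propositional using (Unique)
import Data.List.Relation.Unary.Unique.Propositional.Properties as Unique
open import Data.Maybe using (Maybe; just; nothing)
open import Data.Nat as ℕ using (ℕ; zero; suc; _<_)
import Data.Nat.Properties as ℕ
open import Data.Product using (_×_; _,_; ∃; ∃₂)
open import Data.Sum using ([_,_]′; inj₁; inj₂)
open import Data.Unit.Polymorphic using (⊤; tt)
open import Function using (_∘_)
open import Level using (0ℓ)
open import Relation.Binary.PropositionalEquality as ≡ using (_≡_; _≢_)
open import Relation.Nullary using (yes; no)
open import Relation.Nullary.Decidable using (⌊_⌋; isYes≗does)
import Tactic.RingSolver.Core.AlmostCommutativeRing as ACR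
import Tactic.RingSolver.NonReflective as Solver

-- Indices and lists

-- No division takes place. The inverse of a clique block enters only through weights already
-- multiplied by -yz, so every row of a `u j` has to be scaled by yz first; this is the origin of
-- (yz)^k. The same obstacle returns in det(aI + bJ), whose induction multiplies by a + ib. The
-- determinant formulas are therefore proved over an arbitrary commutative ring with cancellation of
-- such elements as an explicit hypothesis, and ℤ[x] meets it because each of them has a nonzero
-- coefficient at a known position. The determinant is available only as an expansion along the top
-- row. Vanishing for repeated rows is first obtained for the top two rows, then for any row below
-- the top one; this is enough to add lower rows to upper ones and to split block triangular
-- matrices, which is all that the elimination requires. Q arises as y(x - md) - md, and kd = n is
-- what makes the weights clear the clique columns and what lets zQ + kmd² factor.

punchIn-↑ˡ-↑ˡ : ∀ {p} q (j : Fin (suc p)) (l : Fin p) →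
                punchIn (j ↑ˡ q) (l ↑ˡ q) ≡ punchIn j l ↑ˡ q
punchIn-↑ˡ-↑ˡ q zero    l       = ≡.refl
punchIn-↑ˡ-↑ˡ q (suc j) zero    = ≡.refl
punchIn-↑ˡ-↑ˡ q (suc j) (suc l) = ≡.cong suc (punchIn-↑ˡ-↑ˡ q j l)

punchIn-↑ˡ-↑ʳ : ∀ {p} q (j : Fin (suc p)) (l : Fin q) →
                punchIn (j ↑ˡ q) (p ↑ʳ l) ≡ suc p ↑ʳ l
punchIn-↑ˡ-↑ʳ         q zero    l = ≡.refl
punchIn-↑ˡ-↑ʳ {suc p} q (suc j) l = ≡.cong suc (punchIn-↑ˡ-↑ʳ q j l)

eqF-refl : ∀ {n} (i : Fin n) → eqF i i ≡ true
eqF-refl i with i ≟ i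
... | yes _   = ≡.refl
... | no  i≢i = ⊥-elim (i≢i ≡.refl)

eqF-≢ : ∀ {n} {i j : Fin n} → i ≢ j → eqF i j ≡ false
eqF-≢ {i = i} {j} i≢j with i ≟ j
... | yes i≡j = ⊥-elim (i≢j i≡j)
... | no  _   = ≡.refl

eqF-sym : ∀ {n} (i j : Fin n) → eqF i j ≡ eqF j i
eqF-sym i j with i ≟ j
... | yes ≡.refl = ≡.sym (eqF-refl i)
... | no  i≢j    = ≡.sym (eqF-≢ (i≢j ∘ ≡.sym))

module _ {v} {V : Set v} where

  -- Lets a determinant indexed by a concatenation be read as a block matrix on p + q indices; the
  -- `cast` is there because the length of `xs ++ ys` is p + q only up to a proof.
  lookup-++ : ∀ (xs ys : List V) i →
              lookup (xs ++ ys) i ≡ [ lookup xs , lookup ys ]′ (splitAt (length xs) (cast (length-++ xs) i))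
  lookup-++ []       ys i       = ≡.cong (lookup ys) (≡.sym (cast-is-id ≡.refl i))
  lookup-++ (x ∷ xs) ys zero    = ≡.refl
  lookup-++ (x ∷ xs) ys (suc i) with splitAt (length xs) (cast (length-++ xs) i) | lookup-++ xs ys i
  ... | inj₁ _ | eq = eq
  ... | inj₂ _ | eq = eq

  -- Turns distinct positions into distinct vertices: `charPoly` compares positions, whereas the
  -- entries of the matrix are described through vertices.
  lookup-injective : ∀ {xs : List V} → Unique xs → ∀ {i j} → lookup xs i ≡ lookup xs j → i ≡ j
  lookup-injective (_ ∷ _)        {zero}  {zero}  _  = ≡.refl
  lookup-injective (x≢ ∷ _)       {zero}  {suc j} eq = ⊥-elim (All.lookup x≢ (∈-lookup j) eq)
  lookup-injective (x≢ ∷ _)       {suc i} {zero}  eq = ⊥-elim (All.lookup x≢ (∈-lookup i) (≡.sym eq))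
  lookup-injective (_ ∷ unique)   {suc i} {suc j} eq = ≡.cong suc (lookup-injective unique eq)

Unique-concatMap :
  ∀ {a b} {A : Set a} {B : Set b} (f : A → List B) →
  (∀ x → Unique (f x)) → (∀ {x y} → x ≢ y → Disjoint (f x) (f y)) →
  ∀ {xs} → Unique xs → Unique (concatMap f xs)
Unique-concatMap f unique disjoint {xs} xs! =
  Unique.concat⁺ (All.map⁺ (All.universal unique xs)) (AllPairs.map⁺ (AllPairs.map disjoint xs!))

length-concatMap-const :
  ∀ {a b} {A : Set a} {B : Set b} (f : A → List B) {n} → (∀ x → length (f x) ≡ n) →
  ∀ xs → length (concatMap f xs) ≡ length xs ℕ.* n
length-concatMap-const f len []       = ≡.refl
length-concatMap-const f len (x ∷ xs) =
  ≡.trans (length-++ (f x)) (≡.cong₂ ℕ._+_ (len x) (length-concatMap-const f len xs))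

length-allFin : ∀ {n} → length (allFin n) ≡ n
length-allFin = length-tabulate (λ i → i)

-- Sums over indices and over lists

module Sums {c ℓ} (S : Semiring c ℓ) where
  open Semiring S hiding (zero)
  open import Algebra.Properties.Semiring.Sum S

  indicator : Bool → Carrier
  indicator b = if b then 1# else 0#

  sum-indicator : ∀ {n} (f : Fin n → Carrier) j → sum (λ i → indicator (eqF i j) * f i) ≈ f j
  sum-indicator {suc n} f zero = trans
    (+-cong (*-identityˡ _) (trans (sum-cong-≋ λ i → zeroˡ (f (suc i))) (sum-replicate-zero n)))
    (+-identityʳ _)
  sum-indicator {suc n} f (suc j) = trans
    (+-cong (zeroˡ _) (trans (sum-cong-≋ λ i → *-congʳ (eq i j)) (sum-indicator (f ∘ suc) j)))
    (+-identityˡ _)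
    where
    eq : ∀ {n} (i j : Fin n) → indicator (eqF (suc i) (suc j)) ≈ indicator (eqF i j)
    -- The `does` fields of the two decisions agree by computation, so the two tests are compared
    -- through them.
    eq i j = reflexive (≡.cong indicator (≡.trans (isYes≗does (suc i ≟ suc j)) (≡.sym (isYes≗does (i ≟ j)))))

  module _ {v} {V : Set v} where
    sumOver : List V → (V → Carrier) → Carrier
    sumOver xs f = foldr _+_ 0# (map f xs)

    sum-lookup : ∀ xs (f : V → Carrier) → sum (λ i → f (lookup xs i)) ≡ sumOver xs f
    sum-lookup []       f = ≡.refl
    sum-lookup (x ∷ xs) f = ≡.cong (λ c → f x + c) (sum-lookup xs f)

    sumOver-++ : ∀ xs ys (f : V → Carrier) → sumOver (xs ++ ys) f ≈ sumOver xs f + sumOver ys f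
    sumOver-++ []       ys f = sym (+-identityˡ _)
    sumOver-++ (x ∷ xs) ys f = trans (+-congˡ (sumOver-++ xs ys f)) (sym (+-assoc _ _ _))

    sumOver-tabulate : ∀ {n} (g : Fin n → V) (f : V → Carrier) → sumOver (tabulate g) f ≡ sum (f ∘ g)
    sumOver-tabulate {zero}  g f = ≡.refl
    sumOver-tabulate {suc n} g f = ≡.cong (λ c → f (g zero) + c) (sumOver-tabulate (g ∘ suc) f)

  module _ {v w} {V : Set v} {W : Set w} where
    sumOver-map : ∀ (g : V → W) xs f → sumOver (map g xs) f ≡ sumOver xs (f ∘ g)
    sumOver-map g []       f = ≡.refl
    sumOver-map g (x ∷ xs) f = ≡.cong (λ c → f (g x) + c) (sumOver-map g xs f)

    sumOver-concatMap : ∀ (g : V → List W) xs f → sumOver (concatMap g xs) f ≈ sumOver xs (λ x → sumOver (g x) f)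
    sumOver-concatMap g []       f = refl
    sumOver-concatMap g (x ∷ xs) f = trans (sumOver-++ (g x) _ f) (+-congˡ (sumOver-concatMap g xs f))

-- The truncated subtraction in the exponent of x - (n+1) is exact: a divisor k of n satisfies k ≤ n
-- ≤ m(n-1) + 1. Here `suc k`, `suc m` and `suc n` stand for the k, m and n of the theorem.
exponents : ∀ k m d n → suc k ℕ.* d ≡ suc n →
            (suc m ℕ.* n ℕ.+ 1 ℕ.∸ suc k) ℕ.+ suc k ≡ suc m ℕ.* n ℕ.+ 1
exponents k m (suc d) n kd≡n = ℕ.m∸n+n≡m (begin
  suc k              ≤⟨ ℕ.m≤m*n (suc k) (suc d) ⟩
  suc k ℕ.* suc d    ≡⟨ kd≡n ⟩
  suc n              ≡⟨ ℕ.+-comm 1 n ⟩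
  n ℕ.+ 1            ≤⟨ ℕ.+-monoˡ-≤ 1 (ℕ.m≤m+n n (m ℕ.* n)) ⟩
  suc m ℕ.* n ℕ.+ 1  ∎)
  where open ℕ.≤-Reasoning
exponents k m zero    n k0≡n with () ← ≡.trans (≡.sym (ℕ.*-zeroʳ k)) k0≡n

-- The vertices of the graph and their degrees

module Vertices (k m d : ℕ) where

  us : List (CVertex k m d)
  us = map u (allFin k)

  row : Fin m → Fin k → List (CVertex k m d)
  row t j = map (v t j) (allFin d)

  clique : Fin m → List (CVertex k m d)
  clique t = concatMap (row t) (allFin k)

  -- `cVertices k m d` is `us ++ vs` by definition, so the block lemmas for concatenations apply to
  -- it directly.
  vs : List (CVertex k m d)
  vs = concatMap clique (allFin m)

  length-us : length us ≡ k
  length-us = ≡.trans (length-map u (allFin k)) (length-allFin {k})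

  length-clique : ∀ t → length (clique t) ≡ k ℕ.* d
  length-clique t = ≡.trans
    (length-concatMap-const (row t) (λ j → ≡.trans (length-map (v t j) (allFin d)) (length-allFin {d})) (allFin k))
    (≡.cong (ℕ._* d) (length-allFin {k}))

  ∈-us⁻ : ∀ {x} → x ∈ us → ∃ λ j → x ≡ u j
  ∈-us⁻ x∈ with j , _ , x≡ ← ∈-map⁻ u x∈ = j , x≡

  ∈-row⁻ : ∀ {x} t j → x ∈ row t j → ∃ λ s → x ≡ v t j s
  ∈-row⁻ t j x∈ with s , _ , x≡ ← ∈-map⁻ (v t j) x∈ = s , x≡

  ∈-clique⁻ : ∀ {x} t → x ∈ clique t → ∃₂ λ j s → x ≡ v t j s
  ∈-clique⁻ t x∈ with j , x∈row ← Any.satisfied (∈-concatMap⁻ (row t) {xs = allFin k} x∈) = j , ∈-row⁻ t j x∈row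

  ∈-vs⁻ : ∀ {x} → x ∈ vs → ∃ λ t → ∃₂ λ j s → x ≡ v t j s
  ∈-vs⁻ x∈ with t , x∈clique ← Any.satisfied (∈-concatMap⁻ clique {xs = allFin m} x∈) = t , ∈-clique⁻ t x∈clique

  Unique-clique : ∀ t → Unique (clique t)
  Unique-clique t = Unique-concatMap (row t)
    (λ j → Unique.map⁺ (λ { ≡.refl → ≡.refl }) (Unique.allFin⁺ d))
    disjoint
    (Unique.allFin⁺ k)
    where
    disjoint : ∀ {i j} → i ≢ j → Disjoint (row t i) (row t j)
    disjoint {i} {j} i≢j (x∈ , x∈′) with ∈-row⁻ t i x∈ | ∈-row⁻ t j x∈′
    ... | _ , ≡.refl | _ , ≡.refl = i≢j ≡.refl

  Unique-us : Unique us
  Unique-us = Unique.map⁺ (λ { ≡.refl → ≡.refl }) (Unique.allFin⁺ k)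

  Unique-cVertices : Unique (cVertices k m d)
  Unique-cVertices = Unique.++⁺ Unique-us
    (Unique-concatMap clique Unique-clique cliques-disjoint (Unique.allFin⁺ m))
    us-vs-disjoint
    where
    cliques-disjoint : ∀ {s t} → s ≢ t → Disjoint (clique s) (clique t)
    cliques-disjoint {s} {t} s≢t (x∈ , x∈′) with ∈-clique⁻ s x∈ | ∈-clique⁻ t x∈′
    ... | _ , _ , ≡.refl | _ , _ , ≡.refl = s≢t ≡.refl
    us-vs-disjoint : Disjoint us vs
    us-vs-disjoint (x∈ , x∈′) with ∈-us⁻ x∈ | ∈-vs⁻ x∈′
    ... | _ , ≡.refl | _ , _ , _ , ()

  module _ {c ℓ} (S : Semiring c ℓ) where
    open Semiring S
    open import Algebra.Properties.Semiring.Sum S using (sum; sum-cong-≋)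
    open Sums S

    sumOver-us : ∀ f → sumOver us f ≈ sum (f ∘ u)
    sumOver-us f = reflexive (≡.trans (sumOver-map u (allFin k) f) (sumOver-tabulate (λ i → i) (f ∘ u)))

    -- Stated over any semiring because it serves twice: over ℕ for the degrees, over the
    -- coefficient ring for the Schur complement.
    sumOver-vs : ∀ f → sumOver vs f ≈ sum (λ t → sum (λ j → sum (λ s → f (v t j s))))
    sumOver-vs f = begin
      sumOver vs f
        ≈⟨ sumOver-concatMap clique (allFin m) f ⟩
      sumOver (allFin m) (λ t → sumOver (clique t) f)
        ≡⟨ sumOver-tabulate (λ i → i) (λ t → sumOver (clique t) f) ⟩
      sum (λ t → sumOver (clique t) f)
        ≈⟨ sum-cong-≋ {m} (λ t → trans (sumOver-concatMap (row t) (allFin k) f)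
             (reflexive (sumOver-tabulate (λ i → i) (λ j → sumOver (row t j) f)))) ⟩
      sum (λ t → sum (λ j → sumOver (row t j) f))
        ≈⟨ sum-cong-≋ {m} (λ t → sum-cong-≋ {k} λ j → reflexive
             (≡.trans (sumOver-map (v t j) (allFin d) f) (sumOver-tabulate (λ i → i) (f ∘ v t j)))) ⟩
      sum (λ t → sum (λ j → sum (λ s → f (v t j s)))) ∎
      where open import Relation.Binary.Reasoning.Setoid setoid

module _ where
  open import Algebra.Properties.Semiring.Sum ℕ.+-*-semiring
  open Sums ℕ.+-*-semiring

  sum-const : ∀ n c → sum {n} (λ _ → c) ≡ n ℕ.* c
  sum-const zero    c = ≡.refl
  sum-const (suc n) c = ≡.cong (c ℕ.+_) (sum-const n c)

  b2n-indicator : ∀ b → b2n b ≡ indicator b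
  b2n-indicator true  = ≡.refl
  b2n-indicator false = ≡.refl

  sum-eqF : ∀ {n} (i : Fin n) c → sum (λ j → b2n (eqF i j) ℕ.* c) ≡ c
  sum-eqF i c = ≡.trans
    (sum-cong-≗ λ j → ≡.cong (ℕ._* c) (≡.trans (≡.cong b2n (eqF-sym i j)) (b2n-indicator (eqF j i))))
    (sum-indicator (λ _ → c) i)

module Degrees (k m d : ℕ) where
  open Vertices k m d
  private
    S = ℕ.+-*-semiring
  open import Algebra.Properties.Semiring.Sum S
  open Sums S

  degree-u : ∀ j → degree (cVertices k m d) cAdj (u j) ≡ m ℕ.* d
  degree-u j = begin
    sumOver (us ++ vs) (cAdj (u j))
      ≡⟨ sumOver-++ us vs _ ⟩
    sumOver us (cAdj (u j)) ℕ.+ sumOver vs (cAdj (u j))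
      ≡⟨ ≡.cong₂ ℕ._+_ (≡.trans (sumOver-us S _) (sum-replicate-zero k)) (sumOver-vs S _) ⟩
    sum {m} (λ t → sum {k} (λ j′ → sum {d} (λ s → b2n (eqF j j′))))
      ≡⟨ sum-cong-≗ {m} (λ t → ≡.trans
           (sum-cong-≗ {k} λ j′ → ≡.trans (sum-const d _) (ℕ.*-comm d _)) (sum-eqF j d)) ⟩
    sum {m} (λ t → d)
      ≡⟨ sum-const m d ⟩
    m ℕ.* d ∎
    where open ≡.≡-Reasoning

  -- The neighbour `u j` contributes a 1 that is traded for the vertex itself, which its own clique
  -- count omits; the total is then the full clique size and no subtraction occurs.
  degree-v : ∀ t j s → degree (cVertices k m d) cAdj (v t j s) ≡ k ℕ.* d
  degree-v t j s = begin
    sumOver (us ++ vs) (cAdj (v t j s))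
      ≡⟨ sumOver-++ us vs _ ⟩
    sumOver us (cAdj (v t j s)) ℕ.+ sumOver vs (cAdj (v t j s))
      ≡⟨ ≡.cong₂ ℕ._+_ (≡.trans (sumOver-us S _) one-u) (sumOver-vs S _) ⟩
    1 ℕ.+ sum {m} (λ t′ → sum {k} (λ j′ → sum {d} (λ s′ → neighbour t′ j′ s′)))
      ≡⟨ ℕ.+-comm 1 _ ⟩
    sum {m} (λ t′ → sum {k} (λ j′ → sum {d} (λ s′ → neighbour t′ j′ s′))) ℕ.+ 1
      ≡⟨ ≡.cong (sum {m} (λ t′ → sum {k} (λ j′ → sum {d} (λ s′ → neighbour t′ j′ s′))) ℕ.+_) only-self ⟨
    sum {m} (λ t′ → sum {k} (λ j′ → sum {d} (λ s′ → neighbour t′ j′ s′))) ℕ.+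
    sum {m} (λ t′ → sum {k} (λ j′ → sum {d} (λ s′ → self t′ j′ s′)))
      ≡⟨ merge ⟨
    sum {m} (λ t′ → sum {k} (λ j′ → sum {d} (λ s′ → b2n (eqF t t′) ℕ.* 1)))
      ≡⟨ sum-cong-≗ {m} (λ t′ → collapse (b2n (eqF t t′))) ⟩
    sum {m} (λ t′ → b2n (eqF t t′) ℕ.* (k ℕ.* d))
      ≡⟨ sum-eqF t (k ℕ.* d) ⟩
    k ℕ.* d ∎
    where
    open ≡.≡-Reasoning
    -- Counting the vertex itself along with its neighbours gives its whole clique.
    neighbour self : Fin m → Fin k → Fin d → ℕ
    neighbour t′ j′ s′ = b2n (eqF t t′ ∧ not (eqF j j′ ∧ eqF s s′))
    self t′ j′ s′ = b2n (eqF t t′) ℕ.* (b2n (eqF j j′) ℕ.* (b2n (eqF s s′) ℕ.* 1))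

    one-u : sum (λ j′ → b2n (eqF j j′)) ≡ 1
    one-u = ≡.trans (sum-cong-≗ {k} λ j′ → ≡.sym (ℕ.*-identityʳ (b2n (eqF j j′)))) (sum-eqF j 1)

    only-self : sum {m} (λ t′ → sum {k} (λ j′ → sum {d} (λ s′ → self t′ j′ s′))) ≡ 1
    only-self = begin
      sum {m} (λ t′ → sum {k} (λ j′ → sum {d} (λ s′ → self t′ j′ s′)))
        ≡⟨ sum-cong-≗ {m} (λ t′ → sum-cong-≗ {k} λ j′ → pull (b2n (eqF t t′)) (b2n (eqF j j′))) ⟩
      sum {m} (λ t′ → sum {k} (λ j′ → b2n (eqF t t′) ℕ.* (b2n (eqF j j′) ℕ.* 1)))
        ≡⟨ sum-cong-≗ {m} (λ t′ → ≡.sym (*-distribˡ-sum (b2n (eqF t t′)) (λ j′ → b2n (eqF j j′) ℕ.* 1))) ⟩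
      sum {m} (λ t′ → b2n (eqF t t′) ℕ.* sum {k} (λ j′ → b2n (eqF j j′) ℕ.* 1))
        ≡⟨ sum-eqF t _ ⟩
      sum {k} (λ j′ → b2n (eqF j j′) ℕ.* 1)
        ≡⟨ sum-eqF j 1 ⟩
      1 ∎
      where
      pull : ∀ a b → sum {d} (λ s′ → a ℕ.* (b ℕ.* (b2n (eqF s s′) ℕ.* 1))) ≡ a ℕ.* (b ℕ.* 1)
      pull a b = ≡.trans
        (≡.sym (*-distribˡ-sum a (λ s′ → b ℕ.* (b2n (eqF s s′) ℕ.* 1))))
        (≡.cong (a ℕ.*_) (≡.trans (≡.sym (*-distribˡ-sum b (λ s′ → b2n (eqF s s′) ℕ.* 1)))
                                  (≡.cong (b ℕ.*_) (sum-eqF s 1))))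

    merge : sum {m} (λ t′ → sum {k} (λ j′ → sum {d} (λ s′ → b2n (eqF t t′) ℕ.* 1))) ≡
            sum {m} (λ t′ → sum {k} (λ j′ → sum {d} (λ s′ → neighbour t′ j′ s′))) ℕ.+
            sum {m} (λ t′ → sum {k} (λ j′ → sum {d} (λ s′ → self t′ j′ s′)))
    merge = ≡.trans
      (sum-cong-≗ {m} λ t′ → ≡.trans
        (sum-cong-≗ {k} λ j′ → ≡.trans
          (sum-cong-≗ {d} λ s′ → split (eqF t t′) (eqF j j′) (eqF s s′))
          (∑-distrib-+ {d} (neighbour t′ j′) (self t′ j′)))
        (∑-distrib-+ {k} (λ j′ → sum (neighbour t′ j′)) (λ j′ → sum (self t′ j′))))
      (∑-distrib-+ {m} (λ t′ → sum (λ j′ → sum (neighbour t′ j′))) (λ t′ → sum (λ j′ → sum (self t′ j′))))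
      where
      split : ∀ a b c → b2n a ℕ.* 1 ≡ b2n (a ∧ not (b ∧ c)) ℕ.+ b2n a ℕ.* (b2n b ℕ.* (b2n c ℕ.* 1))
      split false b     c     = ≡.refl
      split true  false c     = ≡.refl
      split true  true  false = ≡.refl
      split true  true  true  = ≡.refl

    collapse : ∀ a → sum {k} (λ j′ → sum {d} (λ s′ → a ℕ.* 1)) ≡ a ℕ.* (k ℕ.* d)
    collapse a = begin
      sum {k} (λ j′ → sum {d} (λ s′ → a ℕ.* 1)) ≡⟨ sum-cong-≗ {k} (λ j′ → sum-const d _) ⟩
      sum {k} (λ j′ → d ℕ.* (a ℕ.* 1))         ≡⟨ sum-const k _ ⟩
      k ℕ.* (d ℕ.* (a ℕ.* 1))                  ≡⟨ ℕ.*-assoc k d _ ⟨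
      k ℕ.* d ℕ.* (a ℕ.* 1)                    ≡⟨ ≡.cong (k ℕ.* d ℕ.*_) (ℕ.*-identityʳ a) ⟩
      k ℕ.* d ℕ.* a                            ≡⟨ ℕ.*-comm (k ℕ.* d) a ⟩
      a ℕ.* (k ℕ.* d) ∎

-- Determinants over a commutative ring

module Determinant {c ℓ} (R : CommutativeRing c ℓ) where

  open CommutativeRing R hiding (zero)
  open import Algebra.Properties.Ring ring
  open import Algebra.Properties.Semiring.Sum semiring
  open import Algebra.Properties.Semiring.Exp semiring using (_^_; ^-homo-*; ^-assocʳ)
  open import Algebra.Properties.CommutativeSemiring.Exp commutativeSemiring using (^-distrib-*)
  open import Algebra.Properties.Semiring.Mult semiring using (×-comm-*) renaming (_×_ to _·_)
  open import Algebra.Properties.CommutativeSemigroup *-commutativeSemigroup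
    using () renaming (x∙yz≈y∙xz to x*yz≈y*xz)
  open import Algebra.Properties.CommutativeSemigroup +-commutativeSemigroup
    using () renaming (interchange to +-interchange)
  open import Relation.Binary.Reasoning.Setoid setoid
  open import Algebra.Solver.Ring.NaturalCoefficients.Default commutativeSemiring
  open Sums semiring using (sumOver; sum-lookup)

  Row : ℕ → Set c
  Row n = Fin n → Carrier

  Matrix : ℕ → ℕ → Set c
  Matrix m n = Fin m → Row n

  infixr 5 _◂_
  _◂_ : ∀ {m n} → Row n → Matrix m n → Matrix (suc m) n
  (r ◂ M) zero    = r
  (r ◂ M) (suc i) = M i

  -- Opaque because the reduction of altSum on suc would prevent the inference of its argument.
  opaque
    altSum : ∀ {n} → Row n → Carrier
    altSum {zero}  f = 0#
    altSum {suc n} f = f zero - altSum (f ∘ suc)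

    altSum-cong : ∀ {n} {f g : Row n} → (∀ i → f i ≈ g i) → altSum f ≈ altSum g
    altSum-cong {zero}  f≈g = refl
    altSum-cong {suc n} f≈g = +-cong (f≈g zero) (-‿cong (altSum-cong (f≈g ∘ suc)))

    altSum-zero : ∀ {n} {f : Row n} → (∀ i → f i ≈ 0#) → altSum f ≈ 0#
    altSum-zero {zero}  f≈0 = refl
    altSum-zero {suc n} f≈0 = begin
      _ - _    ≈⟨ +-cong (f≈0 zero) (-‿cong (altSum-zero (f≈0 ∘ suc))) ⟩
      0# - 0#  ≈⟨ -‿inverseʳ 0# ⟩
      0#       ∎

    altSum-+ : ∀ {n} (f g : Row n) → altSum (λ i → f i + g i) ≈ altSum f + altSum g
    altSum-+ {zero}  f g = sym (+-identityˡ 0#)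
    altSum-+ {suc n} f g = begin
      (f zero + g zero) - altSum (λ i → f (suc i) + g (suc i))
        ≈⟨ +-congˡ (-‿cong (altSum-+ (f ∘ suc) (g ∘ suc))) ⟩
      (f zero + g zero) - (altSum (f ∘ suc) + altSum (g ∘ suc))
        ≈⟨ +-congˡ (-‿+-comm _ _) ⟨
      (f zero + g zero) + (- altSum (f ∘ suc) + - altSum (g ∘ suc))
        ≈⟨ +-interchange _ _ _ _ ⟩
      altSum f + altSum g ∎

    altSum-* : ∀ {n} a (f : Row n) → altSum (λ i → a * f i) ≈ a * altSum f
    altSum-* {zero}  a f = sym (zeroʳ a)
    altSum-* {suc n} a f = begin
      a * f zero - altSum (λ i → a * f (suc i))  ≈⟨ +-congˡ (-‿cong (altSum-* a (f ∘ suc))) ⟩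
      a * f zero - a * altSum (f ∘ suc)          ≈⟨ +-congˡ (-‿distribʳ-* _ _) ⟩
      a * f zero + a * - altSum (f ∘ suc)        ≈⟨ distribˡ a _ _ ⟨
      a * altSum f ∎

    altSum-↑ˡ : ∀ p {q} (f : Row (p ℕ.+ q)) → (∀ l → f (p ↑ʳ l) ≈ 0#) →
                altSum f ≈ altSum (λ i → f (i ↑ˡ q))
    altSum-↑ˡ zero    f f≈0 = altSum-zero f≈0
    altSum-↑ˡ (suc p) f f≈0 = +-congˡ (-‿cong (altSum-↑ˡ p (f ∘ suc) f≈0))

    -- Makes the recursion step usable outside the opaque block.
    altSum-suc : ∀ {n} (f : Row (suc n)) → altSum f ≈ f zero - altSum (f ∘ suc)
    altSum-suc f = refl

  -- Expansion along the top row and repeated rows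

  dropCol : ∀ {m n} → Fin (suc n) → Matrix m (suc n) → Matrix m n
  dropCol j M i l = M i (punchIn j l)

  det : ∀ {n} → Matrix n n → Carrier
  det {zero}  M = 1#
  det {suc n} M = altSum (λ j → M zero j * det (dropCol j (M ∘ suc)))

  det-cong : ∀ {n} {M N : Matrix n n} → (∀ i j → M i j ≈ N i j) → det M ≈ det N
  det-cong {zero}  M≈N = refl
  det-cong {suc n} M≈N = altSum-cong λ j →
    *-cong (M≈N zero j) (det-cong (λ i l → M≈N (suc i) (punchIn j l)))

  det-row-+ : ∀ {n} (r s : Row (suc n)) (M : Matrix n (suc n)) →
              det ((λ j → r j + s j) ◂ M) ≈ det (r ◂ M) + det (s ◂ M)
  det-row-+ r s M = trans (altSum-cong λ j → distribʳ _ (r j) (s j)) (altSum-+ _ _)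

  det-row-* : ∀ {n} a (r : Row (suc n)) (M : Matrix n (suc n)) →
              det ((λ j → a * r j) ◂ M) ≈ a * det (r ◂ M)
  det-row-* a r M = trans (altSum-cong λ j → *-assoc a (r j) _) (altSum-* a _)

  -- F j l is indexed by the pair of distinct columns j and punchIn j l; it must not depend on their order.
  Symmetric : ∀ n → (Fin (suc n) → Fin n → Carrier) → Set ℓ
  Symmetric zero    F = ⊤
  Symmetric (suc n) F = (∀ l → F zero l ≈ F (suc l) zero) × Symmetric n (λ j l → F (suc j) (suc l))

  -- Each pair of columns occurs twice, once in either order, and the two occurrences carry opposite
  -- signs because the second index skips the first. The induction peels off column `zero`: the
  -- terms where it comes first cancel those where it comes second.
  altSum-symmetric : ∀ n (F : Fin (suc n) → Fin n → Carrier) → Symmetric n F →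
                     altSum (λ j → altSum (F j)) ≈ 0#
  altSum-symmetric zero    F _             = altSum-zero λ _ → altSum-zero λ ()
  altSum-symmetric (suc n) F (F₀≈F₁ , sym′) = begin
    altSum (λ j → altSum (F j))
      ≈⟨ altSum-suc _ ⟩
    altSum (F zero) - altSum (λ j → altSum (F (suc j)))
      ≈⟨ +-congˡ (-‿cong (altSum-cong λ j → altSum-suc (F (suc j)))) ⟩
    altSum (F zero) - altSum (λ j → F (suc j) zero - altSum (λ l → F (suc j) (suc l)))
      ≈⟨ +-congˡ (-‿cong (altSum-+ (λ j → F (suc j) zero) _)) ⟩
    altSum (F zero) - (A + altSum (λ j → - altSum (λ l → F (suc j) (suc l))))
      ≈⟨ +-congˡ (-‿cong (+-congˡ (altSum-cong λ j → -1*x≈-x _))) ⟨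
    altSum (F zero) - (A + altSum (λ j → - 1# * altSum (λ l → F (suc j) (suc l))))
      ≈⟨ +-congˡ (-‿cong (+-congˡ (altSum-* (- 1#) _))) ⟩
    altSum (F zero) - (A + - 1# * altSum (λ j → altSum (λ l → F (suc j) (suc l))))
      ≈⟨ +-congˡ (-‿cong (+-congˡ (*-congˡ (altSum-symmetric n _ sym′)))) ⟩
    altSum (F zero) - (A + - 1# * 0#)
      ≈⟨ +-congˡ (-‿cong (trans (+-congˡ (zeroʳ _)) (+-identityʳ A))) ⟩
    altSum (F zero) - A
      ≈⟨ +-congʳ (altSum-cong F₀≈F₁) ⟩
    A - A
      ≈⟨ -‿inverseʳ A ⟩
    0# ∎
    where A = altSum (λ j → F (suc j) zero)

  -- `K` is the minor of the remaining rows as a function of the enumeration of the columns kept.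
  -- Abstracting it makes the recursion possible: once column `zero` is known to be kept, `lift 1`
  -- puts it in front of the other kept columns. The two enumerations then agree only pointwise,
  -- hence `K-ext`.
  symmetric-minors :
    ∀ n (r : Row (suc (suc n))) (K : (Fin n → Fin (suc (suc n))) → Carrier) →
    (∀ {g h} → (∀ i → g i ≡ h i) → K g ≈ K h) →
    (F : Fin (suc (suc n)) → Fin (suc n) → Carrier) →
    (∀ j l → F j l ≈ r j * (r (punchIn j l) * K (λ i → punchIn j (punchIn l i)))) →
    Symmetric (suc n) F
  symmetric-minors n r K K-ext F F≈ = edge , rest n r K K-ext F F≈
    where
    edge : ∀ l → F zero l ≈ F (suc l) zero
    -- Deleting `zero` and `suc l` in either order leaves the same enumeration of columns by
    -- computation; only the two factors from `r` have to be exchanged.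
    edge l = trans (F≈ zero l) (trans (x*yz≈y*xz _ _ _) (sym (F≈ (suc l) zero)))
    rest : ∀ n (r : Row (suc (suc n))) (K : (Fin n → Fin (suc (suc n))) → Carrier) →
      (∀ {g h} → (∀ i → g i ≡ h i) → K g ≈ K h) →
      (F : Fin (suc (suc n)) → Fin (suc n) → Carrier) →
      (∀ j l → F j l ≈ r j * (r (punchIn j l) * K (λ i → punchIn j (punchIn l i)))) →
      Symmetric n (λ j l → F (suc j) (suc l))
    rest zero    r K K-ext F F≈ = tt
    rest (suc n) r K K-ext F F≈ =
      symmetric-minors n (r ∘ suc) (K ∘ lift 1)
        (λ g≗h → K-ext λ { zero → ≡.refl ; (suc i) → ≡.cong suc (g≗h i) })
        (λ j l → F (suc j) (suc l))
        (λ j l → trans (F≈ (suc j) (suc l))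
          (*-congˡ (*-congˡ (K-ext λ { zero → ≡.refl ; (suc i) → ≡.refl }))))

  -- Expanding both equal rows gives the terms r_j r_l times a minor that depends only on the set of
  -- deleted columns, so the terms cancel in pairs.
  det-top-equal : ∀ {n} (r : Row (suc (suc n))) (M : Matrix n (suc (suc n))) → det (r ◂ r ◂ M) ≈ 0#
  det-top-equal {n} r M = begin
    altSum (λ j → r j * altSum (λ l → r (punchIn j l) * minor j l))
      ≈⟨ altSum-cong (λ j → altSum-* (r j) _) ⟨
    altSum (λ j → altSum (λ l → r j * (r (punchIn j l) * minor j l)))
      ≈⟨ altSum-symmetric _ _ (symmetric-minors n r (λ g → det (λ i l → M i (g l)))
           (λ g≗h → det-cong λ i l → reflexive (≡.cong (M i) (g≗h l))) _ (λ _ _ → refl)) ⟩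
    0# ∎
    where
    minor : Fin (suc (suc n)) → Fin (suc n) → Carrier
    minor j l = det (dropCol l (dropCol j M))

  det-second-row-+ : ∀ {n} (r s t : Row (suc (suc n))) (M : Matrix n (suc (suc n))) →
                     det (r ◂ (λ j → s j + t j) ◂ M) ≈ det (r ◂ s ◂ M) + det (r ◂ t ◂ M)
  det-second-row-+ r s t M = trans
    (altSum-cong λ j → trans (*-congˡ (det-row-+ (s ∘ punchIn j) (t ∘ punchIn j) (dropCol j M)))
                             (distribˡ (r j) _ _))
    (altSum-+ (λ j → r j * det (dropCol j (s ◂ M))) (λ j → r j * det (dropCol j (t ◂ M))))

  -- Polarization: r + s is placed in both top rows, and the two terms with equal rows vanish.
  det-swap-top : ∀ {n} (r s : Row (suc (suc n))) (M : Matrix n (suc (suc n))) →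
                 det (r ◂ s ◂ M) + det (s ◂ r ◂ M) ≈ 0#
  det-swap-top r s M = begin
    det (r ◂ s ◂ M) + det (s ◂ r ◂ M)
      ≈⟨ +-cong (+-identityˡ _) (+-identityʳ _) ⟨
    (0# + det (r ◂ s ◂ M)) + (det (s ◂ r ◂ M) + 0#)
      ≈⟨ +-cong (+-congʳ (det-top-equal r M)) (+-congˡ (det-top-equal s M)) ⟨
    (det (r ◂ r ◂ M) + det (r ◂ s ◂ M)) + (det (s ◂ r ◂ M) + det (s ◂ s ◂ M))
      ≈⟨ +-cong (det-second-row-+ r r s M) (det-second-row-+ s r s M) ⟨
    det (r ◂ r+s ◂ M) + det (s ◂ r+s ◂ M)
      ≈⟨ det-row-+ r s (r+s ◂ M) ⟨
    det (r+s ◂ r+s ◂ M)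
      ≈⟨ det-top-equal r+s M ⟩
    0# ∎
    where r+s = λ j → r j + s j

  -- Induction on the depth `k` of the copy: only the top two rows can be swapped, and each swap
  -- followed by an expansion brings the copies one row closer.
  det-repeated-row : ∀ {n} (r : Row (suc n)) (M : Matrix n (suc n)) k →
                     (∀ j → r j ≈ M k j) → det (r ◂ M) ≈ 0#
  det-repeated-row r M zero r≈Mₖ =
    trans (det-cong eq) (det-top-equal (M zero) (M ∘ suc))
    where
    eq : ∀ i j → (r ◂ M) i j ≈ (M zero ◂ M zero ◂ M ∘ suc) i j
    eq zero          j = r≈Mₖ j
    eq (suc zero)    j = refl
    eq (suc (suc i)) j = refl
  det-repeated-row {suc n} r M (suc k) r≈Mₖ = begin
    det (r ◂ M)                                        ≈⟨ det-cong eq ⟩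
    det (r ◂ M zero ◂ M ∘ suc)                         ≈⟨ +-identityʳ _ ⟨
    det (r ◂ M zero ◂ M ∘ suc) + 0#                    ≈⟨ +-congˡ swapped ⟨
    det (r ◂ M zero ◂ M ∘ suc) + det (M zero ◂ r ◂ M ∘ suc)
                                                       ≈⟨ det-swap-top r (M zero) (M ∘ suc) ⟩
    0#                                                 ∎
    where
    eq : ∀ i j → (r ◂ M) i j ≈ (r ◂ M zero ◂ M ∘ suc) i j
    eq zero          j = refl
    eq (suc zero)    j = refl
    eq (suc (suc i)) j = refl
    -- After the swap, every minor along the top row has a repeated row.
    swapped : det (M zero ◂ r ◂ M ∘ suc) ≈ 0#
    swapped = altSum-zero λ j → trans
      (*-congˡ (trans (det-cong (split j))
        (det-repeated-row (r ∘ punchIn j) (dropCol j (M ∘ suc)) k (r≈Mₖ ∘ punchIn j))))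
      (zeroʳ _)
      where
      split : ∀ j i l → dropCol j (r ◂ M ∘ suc) i l ≈ (r ∘ punchIn j ◂ dropCol j (M ∘ suc)) i l
      split j zero    l = refl
      split j (suc i) l = refl

  -- Row operations and block matrices

  det-row-combination :
    ∀ {n q} a (r : Row (suc n)) (w : Row q) (s : Matrix q (suc n)) (M : Matrix n (suc n)) →
    (∀ l → det (s l ◂ M) ≈ 0#) →
    det ((λ j → a * r j + sum (λ l → w l * s l j)) ◂ M) ≈ a * det (r ◂ M)
  det-row-combination a r w s M s≈0 = begin
    det ((λ j → a * r j + sum (λ l → w l * s l j)) ◂ M)
      ≈⟨ det-row-+ (λ j → a * r j) _ M ⟩
    det ((λ j → a * r j) ◂ M) + det ((λ j → sum (λ l → w l * s l j)) ◂ M)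
      ≈⟨ +-cong (det-row-* a r M) (vanish _ w s s≈0) ⟩
    a * det (r ◂ M) + 0#
      ≈⟨ +-identityʳ _ ⟩
    a * det (r ◂ M) ∎
    where
    vanish : ∀ q (w : Row q) (s : Matrix q _) → (∀ l → det (s l ◂ M) ≈ 0#) →
             det ((λ j → sum (λ l → w l * s l j)) ◂ M) ≈ 0#
    vanish zero    w s s≈0 = altSum-zero λ j → zeroˡ _
    vanish (suc q) w s s≈0 = begin
      det ((λ j → w zero * s zero j + sum (λ l → w (suc l) * s (suc l) j)) ◂ M)
        ≈⟨ det-row-+ (λ j → w zero * s zero j) _ M ⟩
      det ((λ j → w zero * s zero j) ◂ M) + det ((λ j → sum (λ l → w (suc l) * s (suc l) j)) ◂ M)
        ≈⟨ +-cong (det-row-* (w zero) (s zero) M) (vanish q (w ∘ suc) (s ∘ suc) (s≈0 ∘ suc)) ⟩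
      w zero * det (s zero ◂ M) + 0#
        ≈⟨ +-identityʳ _ ⟩
      w zero * det (s zero ◂ M)
        ≈⟨ trans (*-congˡ (s≈0 zero)) (zeroʳ _) ⟩
      0# ∎

  -- In the expansion along the top row only columns of the left block survive. Each of their minors
  -- has the same shape with one row and column fewer on the left and an unchanged lower right
  -- block, which factors out of the sum.
  det-block-triangular :
    ∀ p {q} (M : Matrix (p ℕ.+ q) (p ℕ.+ q)) →
    (∀ i l → M (i ↑ˡ q) (p ↑ʳ l) ≈ 0#) →
    det M ≈ det (λ i j → M (i ↑ˡ q) (j ↑ˡ q)) * det (λ i j → M (p ↑ʳ i) (p ↑ʳ j))
  det-block-triangular zero    M M≈0 = sym (*-identityˡ _)
  det-block-triangular (suc p) {q} M M≈0 = begin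
    altSum (λ j → M zero j * det (dropCol j (M ∘ suc)))
      ≈⟨ altSum-↑ˡ (suc p) _ (λ l → trans (*-congʳ (M≈0 zero l)) (zeroˡ _)) ⟩
    altSum (λ j → M zero (j ↑ˡ q) * det (dropCol (j ↑ˡ q) (M ∘ suc)))
      ≈⟨ altSum-cong (λ j → *-congˡ (minors j)) ⟩
    altSum (λ j → M zero (j ↑ˡ q) * (upper j * lower))
      ≈⟨ altSum-cong (λ j → trans (sym (*-assoc _ _ _)) (*-comm _ _)) ⟩
    altSum (λ j → lower * (M zero (j ↑ˡ q) * upper j))
      ≈⟨ altSum-* lower _ ⟩
    lower * altSum (λ j → M zero (j ↑ˡ q) * upper j)
      ≈⟨ *-comm _ _ ⟩
    altSum (λ j → M zero (j ↑ˡ q) * upper j) * lower ∎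
    where
    lower = det (λ i j → M (suc p ↑ʳ i) (suc p ↑ʳ j))
    upper : Fin (suc p) → Carrier
    upper j = det (dropCol j (λ i l → M (suc i ↑ˡ q) (l ↑ˡ q)))
    minors : ∀ j → det (dropCol (j ↑ˡ q) (M ∘ suc)) ≈ upper j * lower
    minors j = trans
      (det-block-triangular p (dropCol (j ↑ˡ q) (M ∘ suc))
        (λ i l → trans (reflexive (≡.cong (M _) (punchIn-↑ˡ-↑ʳ q j l))) (M≈0 (suc i) l)))
      (*-cong (det-cong λ i l → reflexive (≡.cong (M _) (punchIn-↑ˡ-↑ˡ q j l)))
              (det-cong λ i l → reflexive (≡.cong (M _) (punchIn-↑ˡ-↑ʳ q j l))))

  -- The rows that are added all come from the bottom part, which stays fixed, so the top rows can
  -- be treated one at a time. `N` is described entrywise rather than constructed, because then its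
  -- minors satisfy the same description.
  det-row-operations :
    ∀ p {q} a (w : Matrix p q) (M N : Matrix (p ℕ.+ q) (p ℕ.+ q)) →
    (∀ i j → N (i ↑ˡ q) j ≈ a * M (i ↑ˡ q) j + sum (λ l → w i l * M (p ↑ʳ l) j)) →
    (∀ l j → N (p ↑ʳ l) j ≈ M (p ↑ʳ l) j) →
    det N ≈ a ^ p * det M
  det-row-operations zero    a w M N top bottom = trans (det-cong bottom) (sym (*-identityˡ _))
  det-row-operations (suc p) {q} a w M N top bottom = begin
    altSum (λ j → N zero j * det (dropCol j (N ∘ suc)))
      ≈⟨ altSum-cong (λ j → *-congˡ (det-row-operations p a (w ∘ suc) (dropCol j (M ∘ suc))
           (dropCol j (N ∘ suc)) (λ i l → top (suc i) (punchIn j l)) (λ l m → bottom l (punchIn j m)))) ⟩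
    altSum (λ j → N zero j * (a ^ p * det (dropCol j (M ∘ suc))))
      ≈⟨ altSum-cong (λ j → x*yz≈y*xz _ _ _) ⟩
    altSum (λ j → a ^ p * (N zero j * det (dropCol j (M ∘ suc))))
      ≈⟨ altSum-* (a ^ p) _ ⟩
    -- The rows below the top one are now those of `M`; the top row remains, and the rows added to
    -- it all occur below it.
    a ^ p * det (N zero ◂ M ∘ suc)
      ≈⟨ *-congˡ (altSum-cong λ j → *-congʳ (top zero j)) ⟩
    a ^ p * det ((λ j → a * M zero j + sum (λ l → w zero l * M (suc p ↑ʳ l) j)) ◂ M ∘ suc)
      ≈⟨ *-congˡ (det-row-combination a (M zero) (w zero) (λ l → M (suc p ↑ʳ l)) (M ∘ suc)
           (λ l → det-repeated-row _ (M ∘ suc) (p ↑ʳ l) (λ _ → refl))) ⟩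
    a ^ p * (a * det M)
      ≈⟨ x*yz≈y*xz _ _ _ ⟩
    a * (a ^ p * det M)
      ≈⟨ *-assoc _ _ _ ⟨
    a ^ suc p * det M ∎

  -- A condition on single elements, so that the formulas below hold in every commutative ring; in
  -- ℤ[x] it comes from `nonzero⇒Cancellable`.
  Cancellable : Carrier → Set _
  Cancellable a = ∀ x y → a * x ≈ a * y → x ≈ y

  Cancellable-cong : ∀ {p q} → p ≈ q → Cancellable p → Cancellable q
  Cancellable-cong p≈q cancel x y qx≈qy =
    cancel x y (trans (*-congʳ p≈q) (trans qx≈qy (*-congʳ (sym p≈q))))

  Cancellable-* : ∀ {p q} → Cancellable p → Cancellable q → Cancellable (p * q)
  Cancellable-* {p} {q} p-cancel q-cancel x y eq =
    q-cancel x y (p-cancel _ _ (trans (sym (*-assoc p q x)) (trans eq (*-assoc p q y))))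

  Cancellable-^ : ∀ {p} → Cancellable p → ∀ n → Cancellable (p ^ n)
  Cancellable-^ p-cancel zero    x y eq = trans (sym (*-identityˡ x)) (trans eq (*-identityˡ y))
  Cancellable-^ p-cancel (suc n) = Cancellable-* p-cancel (Cancellable-^ p-cancel n)

  sum-spike : ∀ {n} (f : Row (suc n)) i {a b} → f i ≈ a → (∀ j → j ≢ i → f j ≈ b) → sum f ≈ a + n · b
  sum-spike {n} f i {a} {b} fᵢ≈a fⱼ≈b = begin
    sum f                          ≈⟨ sum-remove {i = i} f ⟩
    f i + sum (f ∘ punchIn i)      ≈⟨ +-cong fᵢ≈a (sum-cong-≋ λ j → fⱼ≈b _ (punchInᵢ≢i i j)) ⟩
    a + sum {n} (λ _ → b)          ≈⟨ +-congˡ (sum-replicate n) ⟩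
    a + n · b ∎

  det-one : (M : Matrix 1 1) → det M ≈ M zero zero
  det-one M = begin
    altSum (λ j → M zero j * 1#)                 ≈⟨ altSum-suc _ ⟩
    M zero zero * 1# - altSum {0} _              ≈⟨ +-cong (*-identityʳ _) (-‿cong (altSum-zero λ ())) ⟩
    M zero zero - 0#                             ≈⟨ trans (+-congˡ -0#≈0#) (+-identityʳ _) ⟩
    M zero zero ∎

  -- For the matrix aI + bJ of size n + 2, let k = a + (n+1)b. Scaling the top row by k and
  -- subtracting b times every other row leaves only the corner k(a+b) - (n+1)b² = a(a + (n+2)b).
  -- Hence k times the determinant is this corner times a^n k, the determinant of the smaller
  -- matrix, and k is cancelled.
  det-scalar-plus-constant :
    ∀ {n} a b → (∀ i → Cancellable (a + i · b)) → (M : Matrix (suc n) (suc n)) →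
    (∀ i → M i i ≈ a + b) → (∀ i j → i ≢ j → M i j ≈ b) →
    det M ≈ a ^ n * (a + suc n · b)
  det-scalar-plus-constant {zero} a b cancel M diag off = begin
    det M           ≈⟨ det-one M ⟩
    M zero zero     ≈⟨ diag zero ⟩
    a + b           ≈⟨ solve 2 (λ x y → x :+ y := con 1 :* (x :+ (y :+ con 0))) refl a b ⟩
    1# * (a + (b + 0#)) ∎
  det-scalar-plus-constant {suc n} a b cancel M diag off = cancel (suc n) _ _ (begin
    k * det M                                             ≈⟨ *-congʳ (*-identityʳ k) ⟨
    k ^ 1 * det M                                         ≈⟨ det-row-operations 1 k (λ _ _ → - b) M N
                                                               (λ { zero j → refl }) (λ l j → refl) ⟨
    det N                                                 ≈⟨ det-block-triangular 1 N (λ { zero l → cleared l }) ⟩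
    det {1} (λ i j → N (i ↑ˡ suc n) (j ↑ˡ suc n)) * det (λ i j → M (suc i) (suc j))
                                                          ≈⟨ *-cong corner smaller ⟩
    (a * (a + suc (suc n) · b)) * (a ^ n * k)             ≈⟨ solve 4 (λ x y z w → x :* y :* (z :* w) := w :* (x :* z :* y))
                                                               refl a _ _ k ⟩
    k * (a ^ suc n * (a + suc (suc n) · b)) ∎)
    where
    k = a + suc n · b
    -- Since every column of rows 1, …, n+1 sums to k off column 0, the new top row vanishes there.
    N : Matrix (suc (suc n)) (suc (suc n))
    N zero    j = k * M zero j + sum {suc n} (λ l → - b * M (suc l) j)
    N (suc i) j = M (suc i) j
    smaller : det (λ i j → M (suc i) (suc j)) ≈ a ^ n * k
    smaller = det-scalar-plus-constant a b cancel _ (diag ∘ suc) (λ i j i≢j → off (suc i) (suc j) (i≢j ∘ suc-injective))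
    cleared : ∀ l → k * M zero (suc l) + sum {suc n} (λ i → - b * M (suc i) (suc l)) ≈ 0#
    cleared l = begin
      k * M zero (suc l) + sum {suc n} (λ i → - b * M (suc i) (suc l))
        ≈⟨ +-cong (*-congˡ (off zero (suc l) λ ())) (sym (*-distribˡ-sum (- b) (λ i → M (suc i) (suc l)))) ⟩
      k * b + - b * sum {suc n} (λ i → M (suc i) (suc l))
        ≈⟨ +-congˡ (*-congˡ (sum-spike _ l (diag (suc l)) (λ i i≢l → off (suc i) (suc l) (i≢l ∘ suc-injective)))) ⟩
      k * b + - b * ((a + b) + n · b)
        ≈⟨ +-cong (*-comm k b) (trans (*-congˡ (+-assoc a b _)) (sym (-‿distribˡ-* b k))) ⟩
      b * k - b * k
        ≈⟨ -‿inverseʳ _ ⟩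
      0# ∎
    corner : det {1} (λ i j → N (i ↑ˡ suc n) (j ↑ˡ suc n)) ≈ a * (a + suc (suc n) · b)
    corner = begin
      det {1} (λ i j → N (i ↑ˡ suc n) (j ↑ˡ suc n))
        ≈⟨ det-one (λ i j → N (i ↑ˡ suc n) (j ↑ˡ suc n)) ⟩
      k * M zero zero + sum {suc n} (λ l → - b * M (suc l) zero)
        ≈⟨ +-cong (*-congˡ (diag zero)) (sum-cong-≋ λ l → *-congˡ { - b} (off (suc l) zero λ ())) ⟩
      k * (a + b) + sum {suc n} (λ l → - b * b)
        ≈⟨ +-congˡ (sum-replicate (suc n)) ⟩
      k * (a + b) + suc n · (- b * b)
        ≈⟨ +-congˡ (trans (sym (×-comm-* (suc n) (- b) b)) (sym (-‿distribˡ-* b _))) ⟩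
      k * (a + b) - b * (suc n · b)
        ≈⟨ +-congʳ (solve 3 (λ x y z → (x :+ z) :* (x :+ y) := x :* (x :+ (y :+ z)) :+ y :* z) refl a b (suc n · b)) ⟩
      a * (a + suc (suc n) · b) + b * (suc n · b) - b * (suc n · b)
        ≈⟨ trans (+-assoc _ _ _) (trans (+-congˡ (-‿inverseʳ _)) (+-identityʳ _)) ⟩
      a * (a + suc (suc n) · b) ∎

  -- Determinants indexed by lists

  module _ {v} {V : Set v} where
    detOver : List V → (V → V → Carrier) → Carrier
    detOver xs A = det (λ i j → A (lookup xs i) (lookup xs j))

    det-reindex : ∀ {m n} (eq : m ≡ n) (f : Fin m → V) (g : Fin n → V) → (∀ i → f i ≡ g (cast eq i)) →
                  (A : V → V → Carrier) → det (λ i j → A (f i) (f j)) ≈ det (λ i j → A (g i) (g j))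
    det-reindex ≡.refl f g f≗g A = det-cong λ i j →
      reflexive (≡.cong₂ A (≡.trans (f≗g i) (≡.cong g (cast-is-id ≡.refl i)))
                           (≡.trans (f≗g j) (≡.cong g (cast-is-id ≡.refl j))))

    module _ (xs ys : List V) (A : V → V → Carrier) where
      private
        p = length xs
        q = length ys

        vertex : Fin (p ℕ.+ q) → V
        vertex i = [ lookup xs , lookup ys ]′ (splitAt p i)

        M : Matrix (p ℕ.+ q) (p ℕ.+ q)
        M i j = A (vertex i) (vertex j)

        vertex-↑ˡ : ∀ i → vertex (i ↑ˡ q) ≡ lookup xs i
        vertex-↑ˡ i = ≡.cong [ lookup xs , lookup ys ]′ (splitAt-↑ˡ p i q)

        vertex-↑ʳ : ∀ l → vertex (p ↑ʳ l) ≡ lookup ys l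
        vertex-↑ʳ l = ≡.cong [ lookup xs , lookup ys ]′ (splitAt-↑ʳ p q l)

      -- A Schur complement without an inverse: `w` stands for -a times the upper right block times
      -- the inverse of the lower right one, but all that is asked of it is that it clears the upper
      -- right block.
      detOver-schur :
        ∀ a (w : V → V → Carrier) →
        (∀ {x z} → x ∈ xs → z ∈ ys → a * A x z + sumOver ys (λ y → w x y * A y z) ≈ 0#) →
        a ^ length xs * detOver (xs ++ ys) A ≈
        detOver xs (λ x z → a * A x z + sumOver ys (λ y → w x y * A y z)) * detOver ys A
      detOver-schur a w cleared = begin
        a ^ p * detOver (xs ++ ys) A
          ≈⟨ *-congˡ (det-reindex (length-++ xs) (lookup (xs ++ ys)) vertex (lookup-++ xs ys) A) ⟩
        a ^ p * det M
          ≈⟨ det-row-operations p a (λ i l → w (lookup xs i) (lookup ys l)) M N top bottom ⟨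
        det N
          ≈⟨ det-block-triangular p N (λ i l → trans (N-↑ˡ i (p ↑ʳ l))
               (trans (reflexive (≡.cong (B (lookup xs i)) (vertex-↑ʳ l))) (cleared (∈-lookup i) (∈-lookup l)))) ⟩
        det (λ i j → N (i ↑ˡ q) (j ↑ˡ q)) * det (λ i j → N (p ↑ʳ i) (p ↑ʳ j))
          ≈⟨ *-cong
               (det-cong λ i j → trans (N-↑ˡ i (j ↑ˡ q)) (reflexive (≡.cong (B (lookup xs i)) (vertex-↑ˡ j))))
               (det-cong λ i j → trans (bottom i (p ↑ʳ j)) (reflexive (≡.cong₂ A (vertex-↑ʳ i) (vertex-↑ʳ j)))) ⟩
        detOver xs B * detOver ys A ∎
        where
        B : V → V → Carrier
        B x z = a * A x z + sumOver ys (λ y → w x y * A y z)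

        N : Matrix (p ℕ.+ q) (p ℕ.+ q)
        N i j = [ (λ i′ → B (lookup xs i′) (vertex j)) , (λ l → A (lookup ys l) (vertex j)) ]′ (splitAt p i)

        N-↑ˡ : ∀ i j → N (i ↑ˡ q) j ≈ B (lookup xs i) (vertex j)
        N-↑ˡ i j = reflexive (≡.cong [ _ , _ ]′ (splitAt-↑ˡ p i q))

        bottom : ∀ l j → N (p ↑ʳ l) j ≈ M (p ↑ʳ l) j
        bottom l j = reflexive (≡.trans (≡.cong [ _ , _ ]′ (splitAt-↑ʳ p q l))
                                        (≡.cong (λ y → A y (vertex j)) (≡.sym (vertex-↑ʳ l))))

        top : ∀ i j → N (i ↑ˡ q) j ≈ a * M (i ↑ˡ q) j + sum (λ l → w (lookup xs i) (lookup ys l) * M (p ↑ʳ l) j)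
        top i j = trans (N-↑ˡ i j) (sym (+-cong
          (reflexive (≡.cong (λ x → a * A x (vertex j)) (vertex-↑ˡ i)))
          (trans (sum-cong-≋ λ l → *-congˡ (reflexive (≡.cong (λ y → A y (vertex j)) (vertex-↑ʳ l))))
                 (reflexive (sum-lookup ys (λ y → w (lookup xs i) y * A y (vertex j)))))))

      detOver-block-triangular :
        (∀ {x y} → x ∈ xs → y ∈ ys → A x y ≈ 0#) →
        detOver (xs ++ ys) A ≈ detOver xs A * detOver ys A
      detOver-block-triangular A≈0 = begin
        detOver (xs ++ ys) A
          ≈⟨ det-reindex (length-++ xs) (lookup (xs ++ ys)) vertex (lookup-++ xs ys) A ⟩
        det M
          ≈⟨ det-block-triangular p M (λ i l → trans
               (reflexive (≡.cong₂ A (vertex-↑ˡ i) (vertex-↑ʳ l))) (A≈0 (∈-lookup i) (∈-lookup l))) ⟩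
        det (λ i j → M (i ↑ˡ q) (j ↑ˡ q)) * det (λ i j → M (p ↑ʳ i) (p ↑ʳ j))
          ≈⟨ *-cong (det-cong λ i j → reflexive (≡.cong₂ A (vertex-↑ˡ i) (vertex-↑ˡ j)))
                    (det-cong λ i j → reflexive (≡.cong₂ A (vertex-↑ʳ i) (vertex-↑ʳ j))) ⟩
        detOver xs A * detOver ys A ∎

    detOver-scalar-plus-constant :
      ∀ {n} (xs : List V) → Unique xs → length xs ≡ suc n →
      ∀ a b → (∀ i → Cancellable (a + i · b)) → (A : V → V → Carrier) →
      (∀ {x} → x ∈ xs → A x x ≈ a + b) → (∀ {x y} → x ∈ xs → y ∈ xs → x ≢ y → A x y ≈ b) →
      detOver xs A ≈ a ^ n * (a + suc n · b)
    detOver-scalar-plus-constant (_ ∷ xs) unique ≡.refl a b cancel A diag off =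
      det-scalar-plus-constant a b cancel _ (λ i → diag (∈-lookup i))
        (λ i j i≢j → off (∈-lookup i) (∈-lookup j) (i≢j ∘ lookup-injective unique))

  detOver-concatMap :
    ∀ {v w} {V : Set v} {W : Set w} (f : W → List V) (A : V → V → Carrier) a →
    (∀ t → detOver (f t) A ≈ a) → ∀ ts →
    AllPairs (λ s t → ∀ {x y} → x ∈ f s → y ∈ f t → A x y ≈ 0#) ts →
    detOver (concatMap f ts) A ≈ a ^ length ts
  detOver-concatMap f A a blocks []       []              = refl
  detOver-concatMap f A a blocks (t ∷ ts) (t≈0 ∷ ts≈0) = begin
    detOver (f t ++ concatMap f ts) A
      ≈⟨ detOver-block-triangular (f t) (concatMap f ts) A
           (λ x∈ y∈ → let off , y∈f = All.lookupAny t≈0 (∈-concatMap⁻ f y∈) in off x∈ y∈f) ⟩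
    detOver (f t) A * detOver (concatMap f ts) A
      ≈⟨ *-cong (blocks t) (detOver-concatMap f A a blocks ts ts≈0) ⟩
    a ^ suc (length ts) ∎

  -- Multiplication by (yz)^(k+1) lets the exponents be compared by addition alone: for y both sides
  -- reach (m+1)n + 1, for z both reach k + m + 1.
  collect-powers :
    ∀ y z x h Q k m n l → l ℕ.+ suc k ≡ suc m ℕ.* n ℕ.+ 1 →
    (y * z) ^ suc k * (x * z ^ m * y ^ l * h * Q ^ k) ≈
    (z * Q) ^ k * (y * x * h) * (y ^ n * z) ^ suc m
  collect-powers y z x h Q k m n l exponents = begin
    (y * z) ^ suc k * (x * z ^ m * y ^ l * h * Q ^ k)
      ≈⟨ *-congʳ (^-distrib-* y z (suc k)) ⟩
    y ^ suc k * (z * z ^ k) * (x * z ^ m * y ^ l * h * Q ^ k)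
      ≈⟨ solve 8 (λ yk z zk x zm yl h Qk → yk :* (z :* zk) :* (x :* zm :* yl :* h :* Qk) :=
                   zk :* Qk :* (x :* h) :* (yl :* yk) :* (z :* zm)) refl
           (y ^ suc k) z (z ^ k) x (z ^ m) (y ^ l) h (Q ^ k) ⟩
    z ^ k * Q ^ k * (x * h) * (y ^ l * y ^ suc k) * z ^ suc m
      ≈⟨ *-congʳ (*-cong (*-congʳ (^-distrib-* z Q k)) (^-homo-* y l (suc k))) ⟨
    (z * Q) ^ k * (x * h) * y ^ (l ℕ.+ suc k) * z ^ suc m
      ≡⟨ ≡.cong (λ i → (z * Q) ^ k * (x * h) * y ^ i * z ^ suc m) exponents ⟩
    (z * Q) ^ k * (x * h) * y ^ (suc m ℕ.* n ℕ.+ 1) * z ^ suc m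
      ≈⟨ *-congʳ (*-congˡ (trans (^-homo-* y (suc m ℕ.* n) 1) (*-congʳ yⁿᵐ))) ⟩
    (z * Q) ^ k * (x * h) * ((y ^ n) ^ suc m * (y * 1#)) * z ^ suc m
      ≈⟨ solve 6 (λ zQ x h yn y z → zQ :* (x :* h) :* (yn :* (y :* con 1)) :* z := zQ :* (y :* x :* h) :* (yn :* z)) refl
           ((z * Q) ^ k) x h ((y ^ n) ^ suc m) y (z ^ suc m) ⟩
    (z * Q) ^ k * (y * x * h) * ((y ^ n) ^ suc m * z ^ suc m)
      ≈⟨ *-congˡ (^-distrib-* (y ^ n) z (suc m)) ⟨
    (z * Q) ^ k * (y * x * h) * (y ^ n * z) ^ suc m ∎
    where
    yⁿᵐ : y ^ (suc m ℕ.* n) ≈ (y ^ n) ^ suc m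
    yⁿᵐ = trans (reflexive (≡.cong (y ^_) (ℕ.*-comm (suc m) n))) (sym (^-assocʳ y n (suc m)))

-- Elimination of the cliques

module CharacteristicMatrix {c ℓ} (R : CommutativeRing c ℓ) where
  open CommutativeRing R hiding (zero)
  open import Algebra.Properties.Ring ring
  open import Algebra.Properties.Semiring.Sum semiring
  open import Algebra.Properties.Semiring.Exp semiring using (_^_; ^-congˡ)
  open import Algebra.Properties.Semiring.Mult semiring using (×-comm-*; ×-congʳ; ×-assocˡ) renaming (_×_ to _·_)
  open import Algebra.Properties.CommutativeMonoid.Mult +-commutativeMonoid using () renaming (×-distrib-+ to ·-distrib-+)
  open import Relation.Binary.Reasoning.Setoid setoid
  open import Algebra.Solver.Ring.NaturalCoefficients.Default commutativeSemiring
  open Determinant R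
  open Sums semiring

  δ : ∀ {n} → Fin n → Fin n → Carrier
  δ i j = indicator (eqF i j)

  δ-refl : ∀ {n} (i : Fin n) → δ i i ≈ 1#
  δ-refl i = reflexive (≡.cong indicator (eqF-refl i))

  δ-≢ : ∀ {n} {i j : Fin n} → i ≢ j → δ i j ≈ 0#
  δ-≢ i≢j = reflexive (≡.cong indicator (eqF-≢ i≢j))

  module Graph (k′ m d n′ : ℕ) (kd≡n : suc k′ ℕ.* d ≡ suc n′) (e y : Carrier) where
    k = suc k′
    open Vertices k m d

    -- For e = x - md and y = x - (n+1) this is xI - L: adjacency enters with a plus sign, and a
    -- clique block is yI + J. The nested products of `δ` allow sums over t, j and s to be evaluated
    -- one index at a time.
    A : CVertex k m d → CVertex k m d → Carrier
    A (u j)     (u j′)       = δ j′ j * e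
    A (u j)     (v t j′ s)   = δ j′ j
    A (v t j s) (u j′)       = δ j j′
    A (v t j s) (v t′ j′ s′) = δ t t′ * (δ s s′ * (δ j j′ * y) + 1#)

    -- The Schur complement is (e - md/y)I + (md²/(yz))J; after multiplication by yz it is (zq)I +
    -- bJ. `z` is the common row sum y + n of a clique block.
    D z q b : Carrier
    D = d · 1#
    z = y + suc n′ · 1#
    q = y * e - m · D
    b = m · (d · D)

    -- Entry at a vertex of row j′ of −yz times the row of u_j times the inverse (1/y)(I − J/z) of a clique block.
    weight : Fin k → Fin k → Carrier
    weight j j′ = D + δ j′ j * - z

    w : CVertex k m d → CVertex k m d → Carrier
    w (u j) (v t j′ s) = weight j j′
    w _     _          = 0#

    kD≈n : k · D ≈ suc n′ · 1#
    kD≈n = trans (×-assocˡ 1# k d) (reflexive (≡.cong (_· 1#) kd≡n))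

    -- Here kd = n enters: the sum is kd - z = n - (y + n).
    sum-weight : ∀ j → sum (weight j) ≈ - y
    sum-weight j = begin
      sum (λ j′ → D + δ j′ j * - z)               ≈⟨ ∑-distrib-+ {k} (λ _ → D) (λ j′ → δ j′ j * - z) ⟩
      sum {k} (λ _ → D) + sum (λ j′ → δ j′ j * - z) ≈⟨ +-cong (trans (sum-replicate k) kD≈n) (sum-indicator (λ _ → - z) j) ⟩
      suc n′ · 1# - (y + suc n′ · 1#)             ≈⟨ +-congˡ (-‿+-comm y _) ⟨
      suc n′ · 1# + (- y + - (suc n′ · 1#))       ≈⟨ solve 3 (λ x y z → x :+ (y :+ z) := y :+ (x :+ z)) refl _ _ _ ⟩
      - y + (suc n′ · 1# - suc n′ · 1#)           ≈⟨ trans (+-congˡ (-‿inverseʳ _)) (+-identityʳ _) ⟩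
      - y ∎

    schur : CVertex k m d → CVertex k m d → Carrier
    schur x z′ = y * z * A x z′ + sumOver vs (λ y′ → w x y′ * A y′ z′)

    -- Only the clique `t₀` contributes. Its yI part gives y times the weight, its J part d times
    -- the sum of the weights, together (d - zδ)y - yd = -yzδ, the opposite of the scaled entry.
    schur-u-v : ∀ j t₀ j₀ s₀ → schur (u j) (v t₀ j₀ s₀) ≈ 0#
    schur-u-v j t₀ j₀ s₀ = begin
      y * z * δ j₀ j + sumOver vs (λ y′ → w (u j) y′ * A y′ (v t₀ j₀ s₀))
        ≈⟨ +-congˡ (sumOver-vs semiring _) ⟩
      y * z * δ j₀ j + sum (λ t → sum (λ j′ → sum (λ s → weight j j′ * (δ t t₀ * (δ s s₀ * (δ j′ j₀ * y) + 1#)))))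
        ≈⟨ +-congˡ (sum-cong-≋ {m} λ t → trans (sum-cong-≋ {k} (over-s t)) (over-j t)) ⟩
      y * z * δ j₀ j + sum (λ t → δ t t₀ * (weight j j₀ * y + - y * D))
        ≈⟨ +-congˡ (sum-indicator (λ _ → _) t₀) ⟩
      y * z * δ j₀ j + ((D + δ j₀ j * - z) * y + - y * D)
        ≈⟨ solve 6 (λ y y⁻ z z⁻ g D → y :* z :* g :+ ((D :+ g :* z⁻) :* y :+ y⁻ :* D) :=
                                    y :* g :* (z :+ z⁻) :+ D :* (y :+ y⁻)) refl y (- y) z (- z) (δ j₀ j) D ⟩
      y * δ j₀ j * (z - z) + D * (y - y)
        ≈⟨ +-cong (trans (*-congˡ (-‿inverseʳ z)) (zeroʳ _)) (trans (*-congˡ (-‿inverseʳ y)) (zeroʳ _)) ⟩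
      0# + 0#
        ≈⟨ +-identityˡ 0# ⟩
      0# ∎
      where
      over-s : ∀ t j′ → sum (λ s → weight j j′ * (δ t t₀ * (δ s s₀ * (δ j′ j₀ * y) + 1#))) ≈
                        δ t t₀ * (δ j′ j₀ * (weight j j′ * y) + weight j j′ * D)
      over-s t j′ = begin
        sum (λ s → weight j j′ * (δ t t₀ * (δ s s₀ * (δ j′ j₀ * y) + 1#)))
          ≈⟨ sum-cong-≋ {d} (λ s → *-assoc (weight j j′) (δ t t₀) _) ⟨
        sum (λ s → weight j j′ * δ t t₀ * (δ s s₀ * (δ j′ j₀ * y) + 1#))
          ≈⟨ *-distribˡ-sum (weight j j′ * δ t t₀) (λ s → δ s s₀ * (δ j′ j₀ * y) + 1#) ⟨
        weight j j′ * δ t t₀ * sum (λ s → δ s s₀ * (δ j′ j₀ * y) + 1#)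
          ≈⟨ *-congˡ (∑-distrib-+ (λ s → δ s s₀ * (δ j′ j₀ * y)) (λ _ → 1#)) ⟩
        weight j j′ * δ t t₀ * (sum (λ s → δ s s₀ * (δ j′ j₀ * y)) + sum {d} (λ _ → 1#))
          ≈⟨ *-congˡ (+-cong (sum-indicator (λ _ → δ j′ j₀ * y) s₀) (sum-replicate d)) ⟩
        weight j j′ * δ t t₀ * (δ j′ j₀ * y + D)
          ≈⟨ solve 5 (λ w t g y D → w :* t :* (g :* y :+ D) := t :* (g :* (w :* y) :+ w :* D)) refl
               (weight j j′) (δ t t₀) (δ j′ j₀) y D ⟩
        δ t t₀ * (δ j′ j₀ * (weight j j′ * y) + weight j j′ * D) ∎

      over-j : ∀ t → sum (λ j′ → δ t t₀ * (δ j′ j₀ * (weight j j′ * y) + weight j j′ * D)) ≈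
                     δ t t₀ * (weight j j₀ * y + - y * D)
      over-j t = begin
        sum (λ j′ → δ t t₀ * (δ j′ j₀ * (weight j j′ * y) + weight j j′ * D))
          ≈⟨ *-distribˡ-sum (δ t t₀) (λ j′ → δ j′ j₀ * (weight j j′ * y) + weight j j′ * D) ⟨
        δ t t₀ * sum (λ j′ → δ j′ j₀ * (weight j j′ * y) + weight j j′ * D)
          ≈⟨ *-congˡ (∑-distrib-+ (λ j′ → δ j′ j₀ * (weight j j′ * y)) (λ j′ → weight j j′ * D)) ⟩
        δ t t₀ * (sum (λ j′ → δ j′ j₀ * (weight j j′ * y)) + sum (λ j′ → weight j j′ * D))
          ≈⟨ *-congˡ (+-cong (sum-indicator (λ j′ → weight j j′ * y) j₀)
               (trans (sym (*-distribʳ-sum D (weight j))) (*-congʳ (sum-weight j)))) ⟩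
        δ t t₀ * (weight j j₀ * y + - y * D) ∎

    -- Each of the m cliques meets the column of `u j₀` in d vertices of weight d - zδ. The d² terms
    -- make up `b`, and the -zδd terms combine with yzeδ into δ z(ye - md).
    schur-u-u : ∀ j j₀ → schur (u j) (u j₀) ≈ δ j₀ j * (z * q) + b
    schur-u-u j j₀ = begin
      y * z * (δ j₀ j * e) + sumOver vs (λ y′ → w (u j) y′ * A y′ (u j₀))
        ≈⟨ +-congˡ (sumOver-vs semiring _) ⟩
      y * z * (δ j₀ j * e) + sum {m} (λ t → sum {k} (λ j′ → sum {d} (λ s → weight j j′ * δ j′ j₀)))
        ≈⟨ +-congˡ (sum-cong-≋ {m} λ t → trans (sum-cong-≋ {k} over-s) (sum-indicator (λ j′ → d · weight j j′) j₀)) ⟩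
      y * z * (δ j₀ j * e) + sum {m} (λ t → d · weight j j₀)
        ≈⟨ +-congˡ (trans (sum-replicate m) (×-congʳ m (·-distrib-+ D _ d))) ⟩
      y * z * (δ j₀ j * e) + m · (d · D + d · (δ j₀ j * - z))
        ≈⟨ +-congˡ (·-distrib-+ (d · D) _ m) ⟩
      y * z * (δ j₀ j * e) + (b + m · (d · (δ j₀ j * - z)))
        ≈⟨ +-congˡ (+-congˡ (×-congʳ m pull-D)) ⟩
      y * z * (δ j₀ j * e) + (b + m · (δ j₀ j * - z * D))
        ≈⟨ +-congˡ (+-congˡ (×-comm-* m (δ j₀ j * - z) D)) ⟨
      y * z * (δ j₀ j * e) + (b + δ j₀ j * - z * (m · D))
        ≈⟨ +-congˡ (+-congˡ (trans (*-assoc _ _ _) (trans (*-congˡ flip) (sym (*-assoc _ _ _))))) ⟩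
      y * z * (δ j₀ j * e) + (b + δ j₀ j * z * - (m · D))
        ≈⟨ solve 6 (λ y z g e b h → y :* z :* (g :* e) :+ (b :+ g :* z :* h) := g :* (z :* (y :* e :+ h)) :+ b) refl
             y z (δ j₀ j) e b (- (m · D)) ⟩
      δ j₀ j * (z * q) + b ∎
      where
      over-s : ∀ j′ → sum {d} (λ s → weight j j′ * δ j′ j₀) ≈ δ j′ j₀ * (d · weight j j′)
      over-s j′ = begin
        sum {d} (λ s → weight j j′ * δ j′ j₀)   ≈⟨ sum-replicate d ⟩
        d · (weight j j′ * δ j′ j₀)             ≈⟨ ×-congʳ d (*-comm _ _) ⟩
        d · (δ j′ j₀ * weight j j′)             ≈⟨ ×-comm-* d _ _ ⟨
        δ j′ j₀ * (d · weight j j′) ∎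
      pull-D : d · (δ j₀ j * - z) ≈ δ j₀ j * - z * D
      pull-D = trans (×-congʳ d (sym (*-identityʳ _))) (sym (×-comm-* d _ 1#))
      flip : - z * (m · D) ≈ z * - (m · D)
      flip = trans (sym (-‿distribˡ-* z _)) (-‿distribʳ-* z _)

    A-clique-diagonal : ∀ (t : Fin m) (j : Fin k) (s : Fin d) → A (v t j s) (v t j s) ≈ y + 1#
    A-clique-diagonal t j s = begin
      δ t t * (δ s s * (δ j j * y) + 1#)   ≈⟨ *-cong (δ-refl t) (+-congʳ (*-cong (δ-refl s) (*-congʳ (δ-refl j)))) ⟩
      1# * (1# * (1# * y) + 1#)            ≈⟨ solve 1 (λ y → con 1 :* (con 1 :* (con 1 :* y) :+ con 1) := y :+ con 1) refl y ⟩
      y + 1# ∎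

    A-clique-off-diagonal : ∀ (t : Fin m) (j : Fin k) (s : Fin d) j′ s′ → v t j s ≢ v t j′ s′ → δ s s′ * (δ j j′ * y) ≈ 0#
    A-clique-off-diagonal t j s j′ s′ x≢x′ with j ≟ j′ | s ≟ s′
    ... | no  _      | _          = trans (*-congˡ (zeroˡ y)) (zeroʳ _)
    ... | yes _      | no  _      = zeroˡ _
    ... | yes ≡.refl | yes ≡.refl = ⊥-elim (x≢x′ ≡.refl)

    -- The two instances of aI + bJ: a clique block has a = y and b = 1, the scaled Schur complement
    -- has a = zq and the constant `b`.
    module _ (y-cancel : ∀ i → Cancellable (y + i · 1#)) (zq-cancel : ∀ i → Cancellable (z * q + i · b)) where

      det-clique : ∀ t → detOver (clique t) A ≈ y ^ n′ * z
      det-clique t = detOver-scalar-plus-constant (clique t) (Unique-clique t)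
        (≡.trans (length-clique t) kd≡n) y 1# y-cancel A diag off
        where
        diag : ∀ {x} → x ∈ clique t → A x x ≈ y + 1#
        diag x∈ with j , s , ≡.refl ← ∈-clique⁻ t x∈ = A-clique-diagonal t j s
        off : ∀ {x x′} → x ∈ clique t → x′ ∈ clique t → x ≢ x′ → A x x′ ≈ 1#
        off x∈ x′∈ x≢ with j , s , ≡.refl ← ∈-clique⁻ t x∈ | j′ , s′ , ≡.refl ← ∈-clique⁻ t x′∈ = begin
          δ t t * (δ s s′ * (δ j j′ * y) + 1#)   ≈⟨ *-cong (δ-refl t) (+-congʳ (A-clique-off-diagonal t j s j′ s′ x≢)) ⟩
          1# * (0# + 1#)                         ≈⟨ trans (*-identityˡ _) (+-identityˡ _) ⟩
          1# ∎

      det-vs : detOver vs A ≈ (y ^ n′ * z) ^ m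
      det-vs = trans
        (detOver-concatMap clique A _ det-clique (allFin m) (AllPairs.map separate (Unique.allFin⁺ m)))
        (reflexive (≡.cong ((y ^ n′ * z) ^_) (length-allFin {m})))
        where
        separate : ∀ {s t} → s ≢ t → ∀ {x x′} → x ∈ clique s → x′ ∈ clique t → A x x′ ≈ 0#
        separate {s} {t} s≢t x∈ x′∈ with _ , _ , ≡.refl ← ∈-clique⁻ s x∈ | _ , _ , ≡.refl ← ∈-clique⁻ t x′∈ =
          trans (*-congʳ (δ-≢ s≢t)) (zeroˡ _)

      det-us : detOver us schur ≈ (z * q) ^ k′ * (z * q + k · b)
      det-us = detOver-scalar-plus-constant us Unique-us length-us (z * q) b zq-cancel schur diag off
        where
        diag : ∀ {x} → x ∈ us → schur x x ≈ z * q + b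
        diag x∈ with j , ≡.refl ← ∈-us⁻ x∈ =
          trans (schur-u-u j j) (+-congʳ (trans (*-congʳ (δ-refl j)) (*-identityˡ _)))
        off : ∀ {x x′} → x ∈ us → x′ ∈ us → x ≢ x′ → schur x x′ ≈ b
        off x∈ x′∈ x≢ with j , ≡.refl ← ∈-us⁻ x∈ | j′ , ≡.refl ← ∈-us⁻ x′∈ =
          trans (schur-u-u j j′)
            (trans (+-congʳ (trans (*-congʳ (δ-≢ (λ { ≡.refl → x≢ ≡.refl }))) (zeroˡ _))) (+-identityˡ _))

      det-graph : (y * z) ^ k * detOver (cVertices k m d) A ≈
                  (z * q) ^ k′ * (z * q + k · b) * (y ^ n′ * z) ^ m
      det-graph = begin
        (y * z) ^ k * detOver (us ++ vs) A
          ≡⟨ ≡.cong (λ l → (y * z) ^ l * detOver (us ++ vs) A) length-us ⟨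
        (y * z) ^ length us * detOver (us ++ vs) A
          ≈⟨ detOver-schur us vs A (y * z) w cleared ⟩
        detOver us schur * detOver vs A
          ≈⟨ *-cong det-us det-vs ⟩
        (z * q) ^ k′ * (z * q + k · b) * (y ^ n′ * z) ^ m ∎
        where
        cleared : ∀ {x x′} → x ∈ us → x′ ∈ vs → schur x x′ ≈ 0#
        cleared x∈ x′∈ with j , ≡.refl ← ∈-us⁻ x∈ | t , j′ , s , ≡.refl ← ∈-vs⁻ x′∈ = schur-u-v j t j′ s

-- The ring ℤ[x]

-- ≈ₚ unfolds to a function type; wrapping it keeps both sides inferable.
infix 4 _≋_
record _≋_ (p q : Poly) : Set where
  constructor mk
  field at : p ≈ₚ q
open _≋_

coeff-+ₚ : ∀ p q i → coeff (p +ₚ q) i ≡ coeff p i ℤ.+ coeff q i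
coeff-+ₚ []      q       i       = ≡.sym (ℤ.+-identityˡ _)
coeff-+ₚ (a ∷ p) []      i       = ≡.sym (ℤ.+-identityʳ _)
coeff-+ₚ (a ∷ p) (b ∷ q) zero    = ≡.refl
coeff-+ₚ (a ∷ p) (b ∷ q) (suc i) = coeff-+ₚ p q i

coeff-scaleₚ : ∀ a p i → coeff (scaleₚ a p) i ≡ a ℤ.* coeff p i
coeff-scaleₚ a []      i       = ≡.sym (ℤ.*-zeroʳ a)
coeff-scaleₚ a (b ∷ p) zero    = ≡.refl
coeff-scaleₚ a (b ∷ p) (suc i) = coeff-scaleₚ a p i

coeff-∷*-zero : ∀ a p q → coeff ((a ∷ p) *ₚ q) 0 ≡ a ℤ.* coeff q 0
coeff-∷*-zero a p q = ≡.trans (coeff-+ₚ (scaleₚ a q) _ 0) (≡.trans (ℤ.+-identityʳ _) (coeff-scaleₚ a q 0))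

coeff-∷*-suc : ∀ a p q i → coeff ((a ∷ p) *ₚ q) (suc i) ≡ a ℤ.* coeff q (suc i) ℤ.+ coeff (p *ₚ q) i
coeff-∷*-suc a p q i = ≡.trans (coeff-+ₚ (scaleₚ a q) _ (suc i)) (≡.cong (ℤ._+ _) (coeff-scaleₚ a q (suc i)))

-- Mirrors on the right factor the recursion that defines `_*ₚ_` on the left one; commutativity and
-- the absence of zero divisors both rest on having the two.
coeff-*∷-zero : ∀ p b q → coeff (p *ₚ (b ∷ q)) 0 ≡ b ℤ.* coeff p 0
coeff-*∷-zero []      b q = ≡.sym (ℤ.*-zeroʳ b)
coeff-*∷-zero (a ∷ p) b q = ≡.trans (coeff-∷*-zero a p (b ∷ q)) (ℤ.*-comm a b)

coeff-*∷-suc : ∀ p b q i → coeff (p *ₚ (b ∷ q)) (suc i) ≡ b ℤ.* coeff p (suc i) ℤ.+ coeff (p *ₚ q) i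
coeff-*∷-suc []      b q i    = ≡.sym (≡.trans (ℤ.+-identityʳ _) (ℤ.*-zeroʳ b))
coeff-*∷-suc (a ∷ p) b q zero
  rewrite coeff-∷*-suc a p (b ∷ q) 0 | coeff-*∷-zero p b q | coeff-∷*-zero a p q = ℤ.+-comm (a ℤ.* coeff q 0) _
coeff-*∷-suc (a ∷ p) b q (suc i)
  rewrite coeff-∷*-suc a p (b ∷ q) (suc i) | coeff-*∷-suc p b q i | coeff-∷*-suc a p q i =
  swap (a ℤ.* coeff q (suc i)) (b ℤ.* coeff p (suc i)) (coeff (p *ₚ q) i)
  where
  swap : ∀ x y z → x ℤ.+ (y ℤ.+ z) ≡ y ℤ.+ (x ℤ.+ z)
  swap = solve-∀

*ₚ-comm : ∀ p q → p *ₚ q ≈ₚ q *ₚ p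
*ₚ-comm []      []      i       = ≡.refl
*ₚ-comm []      (b ∷ q) zero    = ≡.sym (≡.trans (coeff-∷*-zero b q []) (ℤ.*-zeroʳ b))
*ₚ-comm []      (b ∷ q) (suc i) = ≡.sym (≡.trans (coeff-∷*-suc b q [] i)
  (≡.cong₂ ℤ._+_ (ℤ.*-zeroʳ b) (≡.sym (*ₚ-comm [] q i))))
*ₚ-comm (a ∷ p) q       zero    = ≡.trans (coeff-∷*-zero a p q) (≡.sym (coeff-*∷-zero q a p))
*ₚ-comm (a ∷ p) q       (suc i) = ≡.trans (coeff-∷*-suc a p q i)
  (≡.trans (≡.cong (λ c → a ℤ.* coeff q (suc i) ℤ.+ c) (*ₚ-comm p q i)) (≡.sym (coeff-*∷-suc q a p i)))

*ₚ-congˡ : ∀ p {q r} → q ≈ₚ r → p *ₚ q ≈ₚ p *ₚ r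
*ₚ-congˡ []      q≈r i = ≡.refl
*ₚ-congˡ (a ∷ p) {q} {r} q≈r zero =
  ≡.trans (coeff-∷*-zero a p q) (≡.trans (≡.cong (a ℤ.*_) (q≈r 0)) (≡.sym (coeff-∷*-zero a p r)))
*ₚ-congˡ (a ∷ p) {q} {r} q≈r (suc i) = ≡.trans (coeff-∷*-suc a p q i)
  (≡.trans (≡.cong₂ (λ x y → a ℤ.* x ℤ.+ y) (q≈r (suc i)) (*ₚ-congˡ p q≈r i)) (≡.sym (coeff-∷*-suc a p r i)))

*ₚ-distribˡ : ∀ p q r → p *ₚ (q +ₚ r) ≈ₚ p *ₚ q +ₚ p *ₚ r
*ₚ-distribˡ []      q r i = ≡.refl
*ₚ-distribˡ (a ∷ p) q r zero
  rewrite coeff-∷*-zero a p (q +ₚ r) | coeff-+ₚ q r 0 | coeff-+ₚ ((a ∷ p) *ₚ q) ((a ∷ p) *ₚ r) 0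
        | coeff-∷*-zero a p q | coeff-∷*-zero a p r = ℤ.*-distribˡ-+ a _ _
*ₚ-distribˡ (a ∷ p) q r (suc i)
  rewrite coeff-∷*-suc a p (q +ₚ r) i | coeff-+ₚ q r (suc i) | coeff-+ₚ ((a ∷ p) *ₚ q) ((a ∷ p) *ₚ r) (suc i)
        | coeff-∷*-suc a p q i | coeff-∷*-suc a p r i | *ₚ-distribˡ p q r i | coeff-+ₚ (p *ₚ q) (p *ₚ r) i =
  expand a _ _ _ _
  where
  expand : ∀ a x y z w → a ℤ.* (x ℤ.+ y) ℤ.+ (z ℤ.+ w) ≡ a ℤ.* x ℤ.+ z ℤ.+ (a ℤ.* y ℤ.+ w)
  expand = solve-∀

+ₚ-cong : ∀ {p q r s} → p ≈ₚ q → r ≈ₚ s → p +ₚ r ≈ₚ q +ₚ s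
+ₚ-cong {p} {q} {r} {s} p≈q r≈s i =
  ≡.trans (coeff-+ₚ p r i) (≡.trans (≡.cong₂ ℤ._+_ (p≈q i) (r≈s i)) (≡.sym (coeff-+ₚ q s i)))

+ₚ-comm : ∀ p q → p +ₚ q ≈ₚ q +ₚ p
+ₚ-comm p q i = ≡.trans (coeff-+ₚ p q i) (≡.trans (ℤ.+-comm (coeff p i) _) (≡.sym (coeff-+ₚ q p i)))

+ₚ-assoc : ∀ p q r → (p +ₚ q) +ₚ r ≈ₚ p +ₚ (q +ₚ r)
+ₚ-assoc p q r i rewrite coeff-+ₚ (p +ₚ q) r i | coeff-+ₚ p q i | coeff-+ₚ p (q +ₚ r) i | coeff-+ₚ q r i =
  ℤ.+-assoc (coeff p i) _ _

+ₚ-identityʳ : ∀ p → p +ₚ [] ≈ₚ p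
+ₚ-identityʳ p i = ≡.trans (coeff-+ₚ p [] i) (ℤ.+-identityʳ _)

negₚ-inverseˡ : ∀ p → negₚ p +ₚ p ≈ₚ []
negₚ-inverseˡ p i rewrite coeff-+ₚ (negₚ p) p i | coeff-scaleₚ (ℤ.- 1ℤ) p i | ℤ.-1*i≡-i (coeff p i) =
  ℤ.+-inverseˡ (coeff p i)

scaleₚ-*ₚ : ∀ a p q → scaleₚ a p *ₚ q ≈ₚ scaleₚ a (p *ₚ q)
scaleₚ-*ₚ a []      q i = ≡.refl
scaleₚ-*ₚ a (b ∷ p) q zero
  rewrite coeff-∷*-zero (a ℤ.* b) (scaleₚ a p) q | coeff-scaleₚ a ((b ∷ p) *ₚ q) 0 | coeff-∷*-zero b p q =
  ℤ.*-assoc a b _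
scaleₚ-*ₚ a (b ∷ p) q (suc i)
  rewrite coeff-∷*-suc (a ℤ.* b) (scaleₚ a p) q i | coeff-scaleₚ a ((b ∷ p) *ₚ q) (suc i)
        | coeff-∷*-suc b p q i | scaleₚ-*ₚ a p q i | coeff-scaleₚ a (p *ₚ q) i = expand a b _ _
  where
  expand : ∀ a b x y → a ℤ.* b ℤ.* x ℤ.+ a ℤ.* y ≡ a ℤ.* (b ℤ.* x ℤ.+ y)
  expand = solve-∀

*ₚ-distribʳ : ∀ p q r → (q +ₚ r) *ₚ p ≈ₚ q *ₚ p +ₚ r *ₚ p
*ₚ-distribʳ p q r i = ≡.trans (*ₚ-comm (q +ₚ r) p i)
  (≡.trans (*ₚ-distribˡ p q r i) (+ₚ-cong {p *ₚ q} {q *ₚ p} (*ₚ-comm p q) (*ₚ-comm p r) i))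

*ₚ-assoc : ∀ p q r → (p *ₚ q) *ₚ r ≈ₚ p *ₚ (q *ₚ r)
*ₚ-assoc []      q r i = ≡.refl
*ₚ-assoc (a ∷ p) q r i = ≡.trans (*ₚ-distribʳ r (scaleₚ a q) (0ℤ ∷ (p *ₚ q)) i)
  (+ₚ-cong {scaleₚ a q *ₚ r} {scaleₚ a (q *ₚ r)} {_} {0ℤ ∷ (p *ₚ (q *ₚ r))} (scaleₚ-*ₚ a q r) shift i)
  where
  shift : (0ℤ ∷ (p *ₚ q)) *ₚ r ≈ₚ 0ℤ ∷ (p *ₚ (q *ₚ r))
  shift zero    = ≡.trans (coeff-∷*-zero 0ℤ (p *ₚ q) r) (ℤ.*-zeroˡ (coeff r 0))
  shift (suc i) = ≡.trans (coeff-∷*-suc 0ℤ (p *ₚ q) r i)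
    (≡.trans (≡.cong₂ ℤ._+_ (ℤ.*-zeroˡ (coeff r (suc i))) (*ₚ-assoc p q r i)) (ℤ.+-identityˡ _))

*ₚ-identityˡ : ∀ p → constₚ 1ℤ *ₚ p ≈ₚ p
*ₚ-identityˡ p zero    = ≡.trans (coeff-∷*-zero 1ℤ [] p) (ℤ.*-identityˡ _)
*ₚ-identityˡ p (suc i) = ≡.trans (coeff-∷*-suc 1ℤ [] p i) (≡.trans (ℤ.+-identityʳ _) (ℤ.*-identityˡ _))

polyRing : CommutativeRing 0ℓ 0ℓ
polyRing = record
  { Carrier = Poly ; _≈_ = _≋_ ; _+_ = _+ₚ_ ; _*_ = _*ₚ_ ; -_ = negₚ ; 0# = [] ; 1# = constₚ 1ℤ
  ; isCommutativeRing = record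
    { isRing = record
      { +-isAbelianGroup = record
        { isGroup = record
          { isMonoid = record
            { isSemigroup = record
              { isMagma = record
                { isEquivalence = record
                  { refl  = mk λ i → ≡.refl
                  ; sym   = λ (mk p≈q) → mk λ i → ≡.sym (p≈q i)
                  ; trans = λ (mk p≈q) (mk q≈r) → mk λ i → ≡.trans (p≈q i) (q≈r i) }
                ; ∙-cong = λ {p} {q} (mk p≈q) (mk r≈s) → mk (+ₚ-cong {p} {q} p≈q r≈s) }
              ; assoc = λ p q r → mk (+ₚ-assoc p q r) }
            ; identity = (λ p → mk λ i → ≡.refl) , λ p → mk (+ₚ-identityʳ p) }
          ; inverse = (λ p → mk (negₚ-inverseˡ p))
                    , λ p → mk λ i → ≡.trans (+ₚ-comm p (negₚ p) i) (negₚ-inverseˡ p i)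
          ; ⁻¹-cong = λ {p} {q} (mk p≈q) → mk λ i → ≡.trans (coeff-scaleₚ (ℤ.- 1ℤ) p i)
                        (≡.trans (≡.cong (ℤ.- 1ℤ ℤ.*_) (p≈q i)) (≡.sym (coeff-scaleₚ (ℤ.- 1ℤ) q i))) }
        ; comm = λ p q → mk (+ₚ-comm p q) }
      ; *-cong = λ {p} {q} {r} {s} (mk p≈q) (mk r≈s) → mk λ i →
          ≡.trans (*ₚ-congˡ p r≈s i) (≡.trans (*ₚ-comm p s i) (≡.trans (*ₚ-congˡ s p≈q i) (*ₚ-comm s q i)))
      ; *-assoc = λ p q r → mk (*ₚ-assoc p q r)
      ; *-identity = (λ p → mk (*ₚ-identityˡ p))
                   , λ p → mk λ i → ≡.trans (*ₚ-comm p (constₚ 1ℤ) i) (*ₚ-identityˡ p i)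
      ; distrib = (λ p q r → mk (*ₚ-distribˡ p q r)) , λ p q r → mk (*ₚ-distribʳ p q r) }
    ; *-comm = λ p q → mk (*ₚ-comm p q) } }

-- Low zero coefficients of `p` are stripped until its constant term is nonzero, which happens by
-- position `i`. The lowest coefficient of the product then forces that of `q` to vanish, and the
-- argument repeats on the rest of `q`.
*ₚ-integral : ∀ p i → coeff p i ≢ 0ℤ → ∀ q → p *ₚ q ≈ₚ [] → q ≈ₚ []
*ₚ-integral []      i p≢0 q pq≈0 = ⊥-elim (p≢0 ≡.refl)
*ₚ-integral (a ∷ p) i p≢0 q pq≈0 with a ℤ.≟ 0ℤ
*ₚ-integral (a ∷ p) zero    p≢0 q pq≈0 | yes a≡0 = ⊥-elim (p≢0 a≡0)
*ₚ-integral (a ∷ p) (suc i) p≢0 q pq≈0 | yes ≡.refl = *ₚ-integral p i p≢0 q λ j →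
  ≡.trans (≡.sym (ℤ.+-identityˡ _)) (≡.trans (≡.sym (coeff-∷*-suc 0ℤ p q j)) (pq≈0 (suc j)))
*ₚ-integral (a ∷ p) _ _ q pq≈0 | no a≢0 = go q pq≈0
  where
  go : ∀ q → (a ∷ p) *ₚ q ≈ₚ [] → q ≈ₚ []
  go []      _    i = ≡.refl
  go (b ∷ q) pq≈0 with ℤ.i*j≡0⇒i≡0∨j≡0 a (≡.trans (≡.sym (coeff-∷*-zero a p (b ∷ q))) (pq≈0 0))
  ... | inj₁ a≡0    = ⊥-elim (a≢0 a≡0)
  ... | inj₂ ≡.refl = λ { zero → ≡.refl ; (suc j) → go q (λ i →
    ≡.trans (≡.sym (ℤ.+-identityˡ _)) (≡.trans (≡.sym (coeff-*∷-suc (a ∷ p) 0ℤ q i)) (pq≈0 (suc i)))) j }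

-- Cancellation in ℤ[x] and comparison of the two determinants

module P = CommutativeRing polyRing
open import Algebra.Properties.Ring P.ring using (x∙y⁻¹≈ε⇒x≈y; -‿distribˡ-*; -‿distribʳ-*; -‿+-comm)
open import Algebra.Properties.Semiring.Exp P.semiring using (_^_; ^-congˡ)
open import Algebra.Properties.Semiring.Mult P.semiring using (×-assoc-*; ×-congʳ) renaming (_×_ to _·_)
open import Relation.Binary.Reasoning.Setoid P.setoid
open Determinant polyRing
open CharacteristicMatrix polyRing
open Sums P.semiring using (indicator)

nonzero⇒Cancellable : ∀ p i → coeff p i ≢ 0ℤ → Cancellable p
nonzero⇒Cancellable p i p≢0 q r pq≈pr = x∙y⁻¹≈ε⇒x≈y q r (mk (*ₚ-integral p i p≢0 (q P.- r) (at (begin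
  p * (q - r)         ≈⟨ P.distribˡ p q (- r) ⟩
  p * q + p * (- r)   ≈⟨ P.+-cong pq≈pr (P.sym (-‿distribʳ-* p r)) ⟩
  p * r - p * r       ≈⟨ P.-‿inverseʳ (p * r) ⟩
  [] ∎))))
  where open P using (_*_; _+_; _-_; -_)

^ₚ≡^ : ∀ p n → p ^ₚ n ≡ p ^ n
^ₚ≡^ p zero    = ≡.refl
^ₚ≡^ p (suc n) = ≡.cong (p *ₚ_) (^ₚ≡^ p n)

constₚ-cong : ∀ {a b} → a ≡ b → constₚ a ≋ constₚ b
constₚ-cong a≡b = P.reflexive (≡.cong constₚ a≡b)

sumₚ-cong : ∀ {n} {f g : Fin n → Poly} → (∀ i → f i ≋ g i) → sumₚ f ≋ sumₚ g
sumₚ-cong {zero}  f≋g = P.refl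
sumₚ-cong {suc n} f≋g = P.+-cong (f≋g zero) (sumₚ-cong (f≋g ∘ suc))

sumₚ-neg : ∀ {n} (f : Fin n → Poly) → sumₚ (λ i → negₚ (f i)) ≋ negₚ (sumₚ f)
sumₚ-neg {zero}  f = P.refl
sumₚ-neg {suc n} f = P.trans (P.+-congˡ (sumₚ-neg (f ∘ suc))) (-‿+-comm (f zero) (sumₚ (f ∘ suc)))

constₚ-neg-* : ∀ a p → constₚ (ℤ.- a) *ₚ p ≋ negₚ (constₚ a *ₚ p)
constₚ-neg-* a p = P.trans
  (P.*-congʳ (constₚ-cong (≡.sym (ℤ.-1*i≡-i a))))
  (P.sym (-‿distribˡ-* (constₚ a) p))

-- Pulling one factor -1 out of the tail turns the explicit signs into the nested subtractions of
-- `altSum`.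
sumₚ-signed : ∀ {n} (f : Fin n → Poly) → sumₚ (λ i → constₚ (signℤ (toℕ i)) *ₚ f i) ≋ altSum f
sumₚ-signed {zero}  f = P.sym (altSum-zero λ ())
sumₚ-signed {suc n} f = begin
  constₚ 1ℤ *ₚ f zero +ₚ sumₚ (λ i → constₚ (ℤ.- signℤ (toℕ i)) *ₚ f (suc i))
    ≈⟨ P.+-cong (P.*-identityˡ _) (sumₚ-cong λ i → constₚ-neg-* (signℤ (toℕ i)) (f (suc i))) ⟩
  f zero +ₚ sumₚ (λ i → negₚ (constₚ (signℤ (toℕ i)) *ₚ f (suc i)))
    ≈⟨ P.+-congˡ (P.trans (sumₚ-neg λ i → constₚ (signℤ (toℕ i)) *ₚ f (suc i)) (P.-‿cong (sumₚ-signed (f ∘ suc)))) ⟩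
  f zero P.- altSum (f ∘ suc)
    ≈⟨ altSum-suc f ⟨
  altSum f ∎

det≋ : ∀ {n} (M : Fin n → Fin n → Poly) → Defs.det M ≋ Determinant.det polyRing M
det≋ {zero}  M = P.refl
det≋ {suc n} M = P.trans (sumₚ-signed _)
  (altSum-cong λ j → P.*-congˡ {M zero j} (det≋ (λ i l → M (suc i) (punchIn j l))))

⟪_⟫ : ℕ → Poly
⟪ n ⟫ = constₚ (+ n)

⟪0⟫≋0 : ⟪ 0 ⟫ ≋ []
⟪0⟫≋0 = mk λ { zero → ≡.refl ; (suc i) → ≡.refl }

⟪⟫-* : ∀ a b → ⟪ a ℕ.* b ⟫ ≋ ⟪ a ⟫ *ₚ ⟪ b ⟫
⟪⟫-* a b = P.reflexive (≡.cong constₚ (≡.trans (ℤ.pos-* a b) (≡.sym (ℤ.+-identityʳ _))))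

·1≋⟪⟫ : ∀ n → n · P.1# ≋ ⟪ n ⟫
·1≋⟪⟫ zero    = P.sym ⟪0⟫≋0
·1≋⟪⟫ (suc n) = P.+-congˡ (·1≋⟪⟫ n)

·≋* : ∀ n p → n · p ≋ ⟪ n ⟫ *ₚ p
·≋* n p = P.trans (×-congʳ n (P.sym (P.*-identityˡ p)))
  (P.trans (P.sym (×-assoc-* n P.1# p)) (P.*-congʳ (·1≋⟪⟫ n)))

X-≋ : ∀ n → X- (+ n) ≋ X +ₚ negₚ ⟪ n ⟫
X-≋ n = P.+-congˡ {X} (P.reflexive (≡.cong constₚ (≡.sym (ℤ.-1*i≡-i (+ n)))))

-- Zero test for the ring solver; lists consisting of zeros count as zero too.
0≟ : ∀ p → Maybe ([] ≋ p)
0≟ [] = just P.refl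
0≟ (a ∷ p) with a ℤ.≟ 0ℤ | 0≟ p
... | yes ≡.refl | just (mk []≈p) = just (mk λ { zero → ≡.refl ; (suc i) → []≈p i })
... | _          | _              = nothing

open Solver (ACR.fromCommutativeRing polyRing 0≟) using (solve; _⊕_; _⊗_; ⊝_; Κ)

-- The characteristic polynomial of the graph

module CharPoly (k′ m d n′ : ℕ) (kd≡n : suc k′ ℕ.* d ≡ suc n′) where
  k n : ℕ
  k = suc k′
  n = suc n′
  e y z₁ h Q : Poly
  e  = X- (+ (m ℕ.* d))
  y  = X- (+ (n ℕ.+ 1))
  z₁ = X- (+ 1)
  h  = X- (+ (m ℕ.* d ℕ.+ 1))
  Q  = (X *ₚ X) +ₚ negₚ (constₚ (+ (m ℕ.* d ℕ.+ n ℕ.+ 1)) *ₚ X) +ₚ constₚ (+ (m ℕ.* d ℕ.* n))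

  open Degrees k m d
  open Graph k′ m d n′ kd≡n e y hiding (k)

  y≋ : y ≋ X +ₚ negₚ (⟪ n ⟫ +ₚ P.1#)
  y≋ = X-≋ (n ℕ.+ 1)

  ⟪md⟫ : ⟪ m ℕ.* d ⟫ ≋ ⟪ m ⟫ *ₚ ⟪ d ⟫
  ⟪md⟫ = ⟪⟫-* m d

  e≋ : e ≋ X +ₚ negₚ (⟪ m ⟫ *ₚ ⟪ d ⟫)
  e≋ = P.trans (X-≋ (m ℕ.* d)) (P.+-congˡ {X} (P.-‿cong ⟪md⟫))

  h≋ : h ≋ X +ₚ negₚ (⟪ m ⟫ *ₚ ⟪ d ⟫ +ₚ P.1#)
  h≋ = P.trans (X-≋ (m ℕ.* d ℕ.+ 1)) (P.+-congˡ {X} (P.-‿cong (P.+-congʳ {P.1#} ⟪md⟫)))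

  -- `Q` with the constant md split into a product, so that the solver can treat m, d and n as
  -- separate variables.
  Q′ : Poly
  Q′ = X *ₚ X +ₚ negₚ ((⟪ m ⟫ *ₚ ⟪ d ⟫ +ₚ ⟪ n ⟫ +ₚ P.1#) *ₚ X) +ₚ ⟪ m ⟫ *ₚ ⟪ d ⟫ *ₚ ⟪ n ⟫

  Q≋ : Q ≋ Q′
  Q≋ = P.+-cong
    (P.+-congˡ {X *ₚ X} (P.-‿cong (P.*-congʳ {X} (P.+-congʳ {P.1#} (P.+-congʳ {⟪ n ⟫} ⟪md⟫)))))
    (P.trans (⟪⟫-* (m ℕ.* d) n) (P.*-congʳ {⟪ n ⟫} ⟪md⟫))

  z≋ : z ≋ z₁
  z≋ = begin
    y +ₚ n · P.1#                        ≈⟨ P.+-cong y≋ (·1≋⟪⟫ n) ⟩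
    X +ₚ negₚ (⟪ n ⟫ +ₚ P.1#) +ₚ ⟪ n ⟫   ≈⟨ solve 2 (λ x N → x ⊕ (⊝ (N ⊕ Κ P.1#)) ⊕ N , x ⊕ (⊝ Κ P.1#)) P.refl X ⟪ n ⟫ ⟩
    X +ₚ negₚ P.1#                       ≈⟨ X-≋ 1 ⟨
    z₁ ∎

  -- In (x - (n+1))(x - md) - md the constant term is md(n+1) - md = mdn.
  q≋ : q ≋ Q
  q≋ = begin
    y *ₚ e +ₚ negₚ (m · D)
      ≈⟨ P.+-cong (P.*-cong y≋ e≋) (P.-‿cong (P.trans (·≋* m D) (P.*-congˡ {⟪ m ⟫} (·1≋⟪⟫ d)))) ⟩
    (X +ₚ negₚ (⟪ n ⟫ +ₚ P.1#)) *ₚ (X +ₚ negₚ (⟪ m ⟫ *ₚ ⟪ d ⟫)) +ₚ negₚ (⟪ m ⟫ *ₚ ⟪ d ⟫)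
      ≈⟨ solve 4 (λ x N M D → (x ⊕ (⊝ (N ⊕ Κ P.1#))) ⊗ (x ⊕ (⊝ (M ⊗ D))) ⊕ (⊝ (M ⊗ D)) ,
                  x ⊗ x ⊕ (⊝ ((M ⊗ D ⊕ N ⊕ Κ P.1#) ⊗ x)) ⊕ M ⊗ D ⊗ N) P.refl X ⟪ n ⟫ ⟪ m ⟫ ⟪ d ⟫ ⟩
    Q′
      ≈⟨ Q≋ ⟨
    Q ∎

  b≋ : b ≋ ⟪ m ⟫ *ₚ (⟪ d ⟫ *ₚ ⟪ d ⟫)
  b≋ = P.trans (·≋* m (d · D)) (P.*-congˡ {⟪ m ⟫} (P.trans (·≋* d D) (P.*-congˡ {⟪ d ⟫} (·1≋⟪⟫ d))))

  zq+ib≋ : ∀ i → z *ₚ q +ₚ i · b ≋ z₁ *ₚ Q +ₚ ⟪ i ⟫ *ₚ (⟪ m ⟫ *ₚ (⟪ d ⟫ *ₚ ⟪ d ⟫))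
  zq+ib≋ i = P.+-cong (P.*-cong z≋ q≋) (P.trans (·≋* i b) (P.*-congˡ {⟪ i ⟫} b≋))

  -- Since kd = n, the summand kmd² equals mdn and removes the constant term of (x-1)Q. What is left
  -- is divisible by x, with the further roots n + 1 and md + 1.
  zq+kb≋ : z *ₚ q +ₚ k · b ≋ y *ₚ X *ₚ h
  zq+kb≋ = begin
    z *ₚ q +ₚ k · b
      ≈⟨ zq+ib≋ k ⟩
    z₁ *ₚ Q +ₚ ⟪ k ⟫ *ₚ (⟪ m ⟫ *ₚ (⟪ d ⟫ *ₚ ⟪ d ⟫))
      ≈⟨ P.+-cong (P.*-cong (X-≋ 1) Q≋)
           (solve 3 (λ K M D → K ⊗ (M ⊗ (D ⊗ D)) , M ⊗ (D ⊗ (K ⊗ D))) P.refl ⟪ k ⟫ ⟪ m ⟫ ⟪ d ⟫) ⟩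
    (X +ₚ negₚ P.1#) *ₚ Q′ +ₚ
    ⟪ m ⟫ *ₚ (⟪ d ⟫ *ₚ (⟪ k ⟫ *ₚ ⟪ d ⟫))
      ≈⟨ P.+-congˡ {(X +ₚ negₚ P.1#) *ₚ Q′} (P.*-congˡ {⟪ m ⟫} (P.*-congˡ {⟪ d ⟫}
           (P.trans (P.sym (⟪⟫-* k d)) (P.reflexive (≡.cong ⟪_⟫ kd≡n))))) ⟩
    (X +ₚ negₚ P.1#) *ₚ Q′ +ₚ
    ⟪ m ⟫ *ₚ (⟪ d ⟫ *ₚ ⟪ n ⟫)
      ≈⟨ solve 4 (λ x N M D →
           (x ⊕ (⊝ Κ P.1#)) ⊗ (x ⊗ x ⊕ (⊝ ((M ⊗ D ⊕ N ⊕ Κ P.1#) ⊗ x)) ⊕ M ⊗ D ⊗ N) ⊕ M ⊗ (D ⊗ N) ,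
           (x ⊕ (⊝ (N ⊕ Κ P.1#))) ⊗ x ⊗ (x ⊕ (⊝ (M ⊗ D ⊕ Κ P.1#)))) P.refl X ⟪ n ⟫ ⟪ m ⟫ ⟪ d ⟫ ⟩
    (X +ₚ negₚ (⟪ n ⟫ +ₚ P.1#)) *ₚ X *ₚ (X +ₚ negₚ (⟪ m ⟫ *ₚ ⟪ d ⟫ +ₚ P.1#))
      ≈⟨ P.*-cong (P.*-congʳ {X} y≋) h≋ ⟨
    y *ₚ X *ₚ h ∎

  y-cancel : ∀ i → Cancellable (y +ₚ i · P.1#)
  y-cancel i = Cancellable-cong {y +ₚ ⟪ i ⟫} (P.+-congˡ {y} (P.sym (·1≋⟪⟫ i)))
    (nonzero⇒Cancellable (y +ₚ ⟪ i ⟫) 1 λ ())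

  -- (x-1)Q is a monic cubic, and adding the constant imd² leaves its coefficient at position 3
  -- untouched. The passage to `z₁` and `Q` makes that coefficient computable.
  zq-cancel : ∀ i → Cancellable (z *ₚ q +ₚ i · b)
  zq-cancel i = Cancellable-cong {z₁ *ₚ Q +ₚ ⟪ i ⟫ *ₚ (⟪ m ⟫ *ₚ (⟪ d ⟫ *ₚ ⟪ d ⟫))} (P.sym (zq+ib≋ i))
    (nonzero⇒Cancellable (z₁ *ₚ Q +ₚ ⟪ i ⟫ *ₚ (⟪ m ⟫ *ₚ (⟪ d ⟫ *ₚ ⟪ d ⟫))) 3 λ ())

  const-b2n : ∀ β → ⟪ b2n β ⟫ ≋ indicator β
  const-b2n true  = P.refl
  const-b2n false = ⟪0⟫≋0

  diagonal-entry : ∀ x → X +ₚ negₚ (constₚ (+ degree (cVertices k m d) cAdj x ℤ.- + cAdj x x)) ≋ A x x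
  diagonal-entry (u j) = begin
    X +ₚ negₚ (constₚ (+ degree (cVertices k m d) cAdj (u j) ℤ.- 0ℤ))
      ≈⟨ P.+-congˡ {X} (P.reflexive (≡.cong constₚ (≡.trans (ℤ.-1*i≡-i _)
           (≡.cong ℤ.-_ (≡.trans (ℤ.+-identityʳ _) (≡.cong +_ (degree-u j))))))) ⟩
    e
      ≈⟨ P.trans (P.*-congʳ {e} (δ-refl j)) (P.*-identityˡ e) ⟨
    δ j j *ₚ e ∎
  diagonal-entry (v t j s) = begin
    X +ₚ negₚ (constₚ (+ degree (cVertices k m d) cAdj (v t j s) ℤ.- + cAdj (v t j s) (v t j s)))
      ≈⟨ P.+-congˡ {X} (P.-‿cong (P.reflexive (≡.cong constₚ (≡.trans
           (≡.cong₂ (λ a c → + a ℤ.- + b2n c) (≡.trans (degree-v t j s) kd≡n) not-adjacent)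
           (ℤ.+-identityʳ (+ n)))))) ⟩
    X +ₚ negₚ ⟪ n ⟫
      ≈⟨ solve 2 (λ x N → x ⊕ (⊝ (N ⊕ Κ P.1#)) ⊕ Κ P.1# , x ⊕ (⊝ N)) P.refl X ⟪ n ⟫ ⟨
    X +ₚ negₚ (⟪ n ⟫ +ₚ P.1#) +ₚ P.1#
      ≈⟨ P.+-congʳ {P.1#} y≋ ⟨
    y +ₚ P.1#
      ≈⟨ A-clique-diagonal t j s ⟨
    A (v t j s) (v t j s) ∎
    where
    not-adjacent : eqF t t ∧ not (eqF j j ∧ eqF s s) ≡ false
    not-adjacent rewrite eqF-refl t | eqF-refl j | eqF-refl s = ≡.refl

  off-diagonal-entry : ∀ x x′ → x ≢ x′ → ⟪ cAdj x x′ ⟫ ≋ A x x′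
  off-diagonal-entry (u j) (u j′) x≢x′ = P.trans ⟪0⟫≋0
    (P.sym (P.*-congʳ {e} (δ-≢ {i = j′} {j} λ { ≡.refl → x≢x′ ≡.refl })))
  off-diagonal-entry (u j) (v t j′ s) _ = P.trans (const-b2n (eqF j j′)) (P.reflexive (≡.cong indicator (eqF-sym j j′)))
  off-diagonal-entry (v t j s) (u j′) _ = const-b2n (eqF j j′)
  off-diagonal-entry (v t j s) (v t′ j′ s′) x≢x′ with t ≟ t′
  ... | no  _      = ⟪0⟫≋0
  ... | yes ≡.refl = begin
    ⟪ b2n (not (eqF j j′ ∧ eqF s s′)) ⟫
      ≈⟨ P.reflexive (≡.cong (λ c → ⟪ b2n (not c) ⟫) different) ⟩
    P.1#
      ≈⟨ P.+-congʳ {P.1#} (A-clique-off-diagonal t j s j′ s′ x≢x′) ⟨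
    δ s s′ *ₚ (δ j j′ *ₚ y) +ₚ P.1#
      ≈⟨ P.*-identityˡ _ ⟨
    P.1# *ₚ (δ s s′ *ₚ (δ j j′ *ₚ y) +ₚ P.1#) ∎
    where
    different : eqF j j′ ∧ eqF s s′ ≡ false
    different with j ≟ j′ | s ≟ s′
    ... | no  _      | _          = ≡.refl
    ... | yes _      | no  _      = ≡.refl
    ... | yes ≡.refl | yes ≡.refl = ⊥-elim (x≢x′ ≡.refl)

  entry : ∀ i j → let x = lookup (cVertices k m d) in
          (if ⌊ i ≟ j ⌋ then X else []) +ₚ negₚ (constₚ (L𝒞 k m d i j)) ≋ A (x i) (x j)
  entry i j with i ≟ j
  ... | yes ≡.refl = diagonal-entry (lookup (cVertices k m d) i)
  ... | no  i≢j    = P.trans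
    (P.reflexive (≡.cong constₚ (≡.trans (ℤ.-1*i≡-i _)
      (≡.trans (≡.cong ℤ.-_ (ℤ.+-identityˡ _)) (ℤ.neg-involutive _)))))
    (off-diagonal-entry _ _ (i≢j ∘ lookup-injective (Vertices.Unique-cVertices k m d)))

  charPoly≋ : charPoly (L𝒞 k m d) ≋ detOver (cVertices k m d) A
  charPoly≋ = P.trans (det≋ (λ i j → (if ⌊ i ≟ j ⌋ then X else []) +ₚ negₚ (constₚ (L𝒞 k m d i j))))
    (Determinant.det-cong polyRing entry)

  charPoly-scaled : (y *ₚ z₁) ^ k *ₚ charPoly (L𝒞 k m d) ≋
                    (z₁ *ₚ Q) ^ k′ *ₚ (y *ₚ X *ₚ h) *ₚ (y ^ n′ *ₚ z₁) ^ m
  charPoly-scaled = begin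
    (y *ₚ z₁) ^ k *ₚ charPoly (L𝒞 k m d)
      ≈⟨ P.*-cong (^-congˡ k (P.*-congˡ {y} z≋)) (P.sym charPoly≋) ⟨
    (y *ₚ z) ^ k *ₚ detOver (cVertices k m d) A
      ≈⟨ det-graph y-cancel zq-cancel ⟩
    (z *ₚ q) ^ k′ *ₚ (z *ₚ q +ₚ k · b) *ₚ (y ^ n′ *ₚ z) ^ m
      ≈⟨ P.*-cong (P.*-cong (^-congˡ k′ (P.*-cong z≋ q≋)) zq+kb≋) (^-congˡ m (P.*-congˡ {y ^ n′} z≋)) ⟩
    (z₁ *ₚ Q) ^ k′ *ₚ (y *ₚ X *ₚ h) *ₚ (y ^ n′ *ₚ z₁) ^ m ∎

  yz₁-cancel : Cancellable ((y *ₚ z₁) ^ k)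
  yz₁-cancel = Cancellable-^ {y *ₚ z₁} (Cancellable-* {y} {z₁}
    (nonzero⇒Cancellable y 1 λ ()) (nonzero⇒Cancellable z₁ 1 λ ())) k

open import Data.Nat using (_*_)

theorem5p3 : (n m k d : ℕ) → 0 < n → 0 < m → 0 < k → n ≡ k * d →
    charPoly (L𝒞 k m d) ≈ₚ targetPoly n k m d
theorem5p3 (suc n′) (suc m′) (suc k′) d _ _ _ n≡kd = at
  (yz₁-cancel (charPoly (L𝒞 k m d)) (targetPoly n k m d) (begin
    (y *ₚ z₁) ^ k *ₚ charPoly (L𝒞 k m d)
      ≈⟨ charPoly-scaled ⟩
    (z₁ *ₚ Q) ^ k′ *ₚ (y *ₚ X *ₚ h) *ₚ (y ^ n′ *ₚ z₁) ^ m
      ≈⟨ collect-powers y z₁ X h Q k′ m′ n′ l (exponents k′ m′ d n′ (≡.sym n≡kd)) ⟨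
    (y *ₚ z₁) ^ k *ₚ (X *ₚ z₁ ^ m′ *ₚ y ^ l *ₚ h *ₚ Q ^ k′)
      ≈⟨ P.*-congˡ {(y *ₚ z₁) ^ k} (P.reflexive powers) ⟩
    (y *ₚ z₁) ^ k *ₚ targetPoly n k m d ∎))
  where
  m = suc m′
  open CharPoly k′ m d n′ (≡.sym n≡kd)
  l = m ℕ.* n′ ℕ.+ 1 ℕ.∸ k
  powers : X *ₚ z₁ ^ m′ *ₚ y ^ l *ₚ h *ₚ Q ^ k′ ≡ targetPoly n k m d
  -- On successors the exponents m - 1, n - 1 and k - 1 compute, so the two sides differ only in the
  -- power function used.
  powers rewrite ^ₚ≡^ z₁ m′ | ^ₚ≡^ y l | ^ₚ≡^ Q k′ = ≡.refl
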